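{- (a) Fix $n>0$. For any relational signature $\Sigma$ and any set $Q$ of $\mathcal{EL}(\Sigma)$-queries with $|Q|\le n$, one can compute in polynomial time a split partner $\mathcal S(Q)$ of $Q$ in $\mathcal{EL}(\Sigma)$. (b) For any finite set $Q$ of $\mathcal{ELI}(\Sigma)$-queries, one can compute in exponential time a split partner of $Q$ in $\mathcal{ELI}(\Sigma)$. (c) Even for singleton sets $Q$ of $\mathcal{ELI}(\Sigma)$-queries, no polynomial-size split partner of $Q$ in $\mathcal{ELI}(\Sigma)$ exists in general: there is no polynomial $f$ such that for every relational signature $\Sigma$ and every $\mathcal{ELI}(\Sigma)$-query $q$ there is a split partner of $\{q\}$ in $\mathcal{ELI}(\Sigma)$ of total size at most $f(|q|+|\Sigma|)$.
   Context: A relational signature $\Sigma$ is a finite nonempty set of unary and binary predicate symbols. A $\Sigma$-data instance $\mathcal A$ is a finite set of facts $A(a)$, $P(a,b)$ with $A,P\in\Sigma$ and individual names $a,b$; $P^-(a,b)\in\mathcal A$ means $P(b,a)\in\mathcal A$. A pointed $\Sigma$-data instance is a pair $(\mathcal A,a)$ with $a$ an individual name of $\mathcal A$. $\mathcal{ELI}(\Sigma)$-queries are built from $\top$ and unary symbols of $\Sigma$ using $\wedge$ and $\exists S.q$, where $S$ is $P$ or $P^-$ for a binary $P\in\Sigma$; $\mathcal{EL}(\Sigma)$-queries are those without inverses $P^-$. $\mathcal A\models q(a)$ is defined by: $\mathcal A\models A(a)$ iff $A(a)\in\mathcal A$; $\mathcal A\models(\exists S.q)(a)$ iff $S(a,b)\in\mathcal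 A$ and $\mathcal A\models q(b)$ for some $b$; $\top,\wedge$ as usual. $q'\models q$ means that $\mathcal A\models q'(a)$ implies $\mathcal A\models q(a)$ for all pointed $(\mathcal A,a)$. $|q|$ is the number of symbols in $q$. For $\mathcal L\in\{\mathcal{EL},\mathcal{ELI}\}$ and a finite set $Q$ of $\mathcal L(\Sigma)$-queries, a finite set $\mathcal S(Q)$ of pointed $\Sigma$-data instances is a split partner of $Q$ in $\mathcal L(\Sigma)$ if for all $\mathcal L(\Sigma)$-queries $q'$ the following are equivalent: (1) $\mathcal A\models q'(a)$ for some $(\mathcal A,a)\in\mathcal S(Q)$; (2) $q'\not\models q$ for all $q\in Q$. Its total size is the total number of facts in its members. Polynomial/exponential time is measured in the total size of $Q$ and $\Sigma$.
   Formalization: The point a of a pointed data instance need not occur in a fact of 𝒜; if it had to, (a) and (b) would fail: for Σ = Q = {A, B}, ⊤ entails neither A nor B, yet every occurring point satisfies A or B, so no split partner exists. -}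

module Defs where

open import Data.Fin using (Fin; toℕ)
import Data.Fin.Properties as Fin
open import Data.List using (List; []; _∷_; length; map; sum; deduplicate)
open import Data.List.Membership.Propositional using (_∈_)
open import Data.List.Relation.Unary.All using (All)
open import Data.List.Relation.Unary.Any using (Any)
open import Data.Nat using (ℕ; zero; suc; _+_; _*_; _≤_; _<_)
import Data.Nat.Properties as ℕ
open import Data.Product using (∃-syntax; _×_; _,_)
open import Data.Unit using (⊤)
open import Data.Vec using (Vec; []; _∷_; lookup)
open import Function.Bundles using (_⇔_)
open import Relation.Binary.Definitions using (DecidableEquality)
open import Relation.Binary.PropositionalEquality using (refl)
open import Relation.Nullary using (¬_; no)
open import Relation.Nullary.Decidable using (map′; _×-dec_)

-- The symbols of a signature are numbered: Fin unary are its unary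
-- symbols and Fin binary its binary ones.
record Signature : Set where
  field
    unary    : ℕ
    binary   : ℕ
    nonempty : 0 < unary + binary

open Signature public

∣_∣ₛ : Signature → ℕ
∣ Σ ∣ₛ = unary Σ + binary Σ

Individual : Set
Individual = ℕ

data Fact (Σ : Signature) : Set where
  concept : Fin (unary Σ) → Individual → Fact Σ
  role    : Fin (binary Σ) → Individual → Individual → Fact Σ

-- Finite sets (of facts, queries, pointed instances) are given by lists
-- enumerating their elements.
Instance : Signature → Set
Instance Σ = List (Fact Σ)

-- The point need not occur in a fact.  Otherwise Q = {A, B} over the
-- signature {A, B} would have no split partner: the query ⊤ entails
-- neither A nor B, but every point occurring in a fact satisfies one of them.
PointedInstance : Signature → Set
PointedInstance Σ = Instance Σ × Individual

data Language : Set where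
  EL ELI : Language

data Role (Σ : Signature) : Language → Set where
  fwd : ∀ {L} → Fin (binary Σ) → Role Σ L
  inv : Fin (binary Σ) → Role Σ ELI

data Query (Σ : Signature) (L : Language) : Set where
  top  : Query Σ L
  atom : Fin (unary Σ) → Query Σ L
  _∧_  : Query Σ L → Query Σ L → Query Σ L
  some : Role Σ L → Query Σ L → Query Σ L

roleFact : ∀ {Σ L} → Role Σ L → Individual → Individual → Fact Σ
roleFact (fwd P) a b = role P a b
roleFact (inv P) a b = role P b a

infix 4 _⊨_ _entails_

_⊨_ : ∀ {Σ L} → PointedInstance Σ → Query Σ L → Set
(𝒜 , a) ⊨ top      = ⊤
(𝒜 , a) ⊨ atom A   = concept A a ∈ 𝒜
(𝒜 , a) ⊨ q₁ ∧ q₂  = ((𝒜 , a) ⊨ q₁) × ((𝒜 , a) ⊨ q₂)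
(𝒜 , a) ⊨ some S q = ∃[ b ] (roleFact S a b ∈ 𝒜 × ((𝒜 , b) ⊨ q))

_entails_ : ∀ {Σ L} → Query Σ L → Query Σ L → Set
_entails_ {Σ} q′ q = (𝒜a : PointedInstance Σ) → 𝒜a ⊨ q′ → 𝒜a ⊨ q

IsSplitPartner : ∀ {Σ L} → List (Query Σ L) → List (PointedInstance Σ) → Set
IsSplitPartner {Σ} {L} Q S =
  (q′ : Query Σ L) →
  Any (λ 𝒜a → 𝒜a ⊨ q′) S ⇔ All (λ q → ¬ (q′ entails q)) Q

∣_∣ : ∀ {Σ L} → Query Σ L → ℕ
∣ top ∣      = 1
∣ atom A ∣   = 1
∣ q₁ ∧ q₂ ∣  = 1 + (∣ q₁ ∣ + ∣ q₂ ∣)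
∣ some S q ∣ = 2 + ∣ q ∣

inputSize : (Σ : Signature) {L : Language} → List (Query Σ L) → ℕ
inputSize Σ Q = ∣ Σ ∣ₛ + sum (map ∣_∣ Q)

_≟ᶠ_ : ∀ {Σ} → DecidableEquality (Fact Σ)
concept A a ≟ᶠ concept B b =
  map′ (λ { (refl , refl) → refl }) (λ { refl → refl , refl })
       (A Fin.≟ B ×-dec a ℕ.≟ b)
concept _ _ ≟ᶠ role _ _ _ = no λ ()
role _ _ _ ≟ᶠ concept _ _ = no λ ()
role P a b ≟ᶠ role R c d =
  map′ (λ { (refl , refl , refl) → refl }) (λ { refl → refl , refl , refl })
       (P Fin.≟ R ×-dec a ℕ.≟ c ×-dec b ℕ.≟ d)

numFacts : ∀ {Σ} → Instance Σ → ℕ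
numFacts 𝒜 = length (deduplicate _≟ᶠ_ 𝒜)

-- A member listed twice is counted twice; deleting the repetition gives
-- a smaller list with the same members.
totalSize : ∀ {Σ} → List (PointedInstance Σ) → ℕ
totalSize S = sum (map (λ { (𝒜 , _) → numFacts 𝒜 }) S)

-- Coefficients, constant term first.  As polynomials only serve as upper
-- bounds, natural coefficients are enough.
Polynomial : Set
Polynomial = List ℕ

eval : Polynomial → ℕ → ℕ
eval []      x = 0
eval (c ∷ p) x = c + x * eval p x

-- The machine model is a first-order call-by-value functional language
-- over binary trees, in the style of Jones's language F.  Every rule is
-- charged at least 1, and every rule that copies or builds a tree is
-- charged the full size of that tree (so sharing cannot produce large
-- trees cheaply).  Hence the cost is polynomially related to the running
-- time of a Turing machine.

data Tree : Set where
  leaf : Tree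
  node : Tree → Tree → Tree

treeSize : Tree → ℕ
treeSize leaf       = 1
treeSize (node s t) = 1 + (treeSize s + treeSize t)

-- Exp k n: expressions with k function symbols, all unary, and n
-- variables.  The last argument of `case` binds the two subtrees, the
-- left one being variable 0.
data Exp (k n : ℕ) : Set where
  var  : Fin n → Exp k n
  leaf : Exp k n
  node : Exp k n → Exp k n → Exp k n
  case : Exp k n → Exp k n → Exp k (2 + n) → Exp k n
  bind : Exp k n → Exp k (1 + n) → Exp k n
  call : Fin k → Exp k n → Exp k n

record Program : Set where
  field
    funs : ℕ
    body : Fin funs → Exp funs 1
    main : Exp funs 1

-- body ∣ ρ ⊢ e ⇓ v ⟨ c ⟩: in environment ρ, e evaluates to v at cost c.
infix 4 _∣_⊢_⇓_⟨_⟩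

data _∣_⊢_⇓_⟨_⟩ {k : ℕ} (body : Fin k → Exp k 1) :
       {n : ℕ} → Vec Tree n → Exp k n → Tree → ℕ → Set where

  ⇓var : ∀ {n} {ρ : Vec Tree n} {i} →
         body ∣ ρ ⊢ var i ⇓ lookup ρ i ⟨ treeSize (lookup ρ i) ⟩

  ⇓leaf : ∀ {n} {ρ : Vec Tree n} →
          body ∣ ρ ⊢ leaf ⇓ leaf ⟨ 1 ⟩

  ⇓node : ∀ {n} {ρ : Vec Tree n} {e₁ e₂ v₁ v₂ c₁ c₂} →
          body ∣ ρ ⊢ e₁ ⇓ v₁ ⟨ c₁ ⟩ →
          body ∣ ρ ⊢ e₂ ⇓ v₂ ⟨ c₂ ⟩ →
          body ∣ ρ ⊢ node e₁ e₂ ⇓ node v₁ v₂ ⟨ c₁ + c₂ + treeSize (node v₁ v₂) ⟩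

  ⇓case-leaf : ∀ {n} {ρ : Vec Tree n} {e e₁ e₂ v c c₁} →
               body ∣ ρ ⊢ e ⇓ leaf ⟨ c ⟩ →
               body ∣ ρ ⊢ e₁ ⇓ v ⟨ c₁ ⟩ →
               body ∣ ρ ⊢ case e e₁ e₂ ⇓ v ⟨ c + c₁ + 1 ⟩

  ⇓case-node : ∀ {n} {ρ : Vec Tree n} {e e₁ e₂ s t v c c₂} →
               body ∣ ρ ⊢ e ⇓ node s t ⟨ c ⟩ →
               body ∣ s ∷ t ∷ ρ ⊢ e₂ ⇓ v ⟨ c₂ ⟩ →
               body ∣ ρ ⊢ case e e₁ e₂ ⇓ v ⟨ c + c₂ + 1 ⟩

  ⇓bind : ∀ {n} {ρ : Vec Tree n} {e₁ e₂ v₁ v c₁ c₂} →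
          body ∣ ρ ⊢ e₁ ⇓ v₁ ⟨ c₁ ⟩ →
          body ∣ v₁ ∷ ρ ⊢ e₂ ⇓ v ⟨ c₂ ⟩ →
          body ∣ ρ ⊢ bind e₁ e₂ ⇓ v ⟨ c₁ + c₂ + 1 ⟩

  ⇓call : ∀ {n} {ρ : Vec Tree n} {f e v₁ v c₁ c₂} →
          body ∣ ρ ⊢ e ⇓ v₁ ⟨ c₁ ⟩ →
          body ∣ v₁ ∷ [] ⊢ body f ⇓ v ⟨ c₂ ⟩ →
          body ∣ ρ ⊢ call f e ⇓ v ⟨ c₁ + c₂ + 1 ⟩

_maps_to_within_ : Program → Tree → Tree → ℕ → Set
p maps input to output within bound =
  ∃[ c ] ((Program.body p ∣ input ∷ [] ⊢ Program.main p ⇓ output ⟨ c ⟩) × c ≤ bound)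

-- Numbers are encoded in unary, so the encoding of (Σ , Q) has size
-- polynomial in inputSize Σ Q.

encodeℕ : ℕ → Tree
encodeℕ zero    = leaf
encodeℕ (suc n) = node leaf (encodeℕ n)

encodeFin : ∀ {n} → Fin n → Tree
encodeFin i = encodeℕ (toℕ i)

encodeList : {X : Set} → (X → Tree) → List X → Tree
encodeList enc []       = leaf
encodeList enc (x ∷ xs) = node (enc x) (encodeList enc xs)

encodeRole : ∀ {Σ L} → Role Σ L → Tree
encodeRole (fwd P) = node (encodeℕ 0) (encodeFin P)
encodeRole (inv P) = node (encodeℕ 1) (encodeFin P)

encodeQuery : ∀ {Σ L} → Query Σ L → Tree
encodeQuery top        = node (encodeℕ 0) leaf
encodeQuery (atom A)   = node (encodeℕ 1) (encodeFin A)
encodeQuery (q₁ ∧ q₂)  = node (encodeℕ 2) (node (encodeQuery q₁) (encodeQuery q₂))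
encodeQuery (some S q) = node (encodeℕ 3) (node (encodeRole S) (encodeQuery q))

encodeInput : (Σ : Signature) {L : Language} → List (Query Σ L) → Tree
encodeInput Σ Q =
  node (node (encodeℕ (unary Σ)) (encodeℕ (binary Σ))) (encodeList encodeQuery Q)

encodeFact : ∀ {Σ} → Fact Σ → Tree
encodeFact (concept A a) = node (encodeℕ 0) (node (encodeFin A) (encodeℕ a))
encodeFact (role P a b)  =
  node (encodeℕ 1) (node (encodeFin P) (node (encodeℕ a) (encodeℕ b)))

encodePointed : ∀ {Σ} → PointedInstance Σ → Tree
encodePointed (𝒜 , a) = node (encodeList encodeFact 𝒜) (encodeℕ a)

encodeOutput : ∀ {Σ} → List (PointedInstance Σ) → Tree
encodeOutput = encodeList encodePointed

module Submission where

-- Both split partners consist of points of one canonical instance.  Its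
-- individuals are sets t of subqueries of Q that are to be false at t:
-- the fact A(t) is present unless A is in t, and P(t, u) is present unless
-- for some ∃P.r in t all conjuncts of r may be true at u, or symmetrically
-- for ∃P⁻.r in u.  Hence a query with a conjunct in t is false at t, while
-- a query q′ is true at the point of the subqueries that it does not entail.
-- With inverse roles a successor must respect everything known about its
-- predecessor, and all sets of subqueries are needed.  In EL a successor only
-- has to refute one conjunct of r for each ∃P.r in t, so sets with at most one
-- subquery of each q in Q are enough, and there are polynomially many of them.
--
-- The program computing this is a table of first-order functions.  An
-- expression that calls polynomially bounded functions is polynomially
-- bounded, and so is a recursion that makes linearly many calls.
--
-- For the lower bound, q = ∃R.⋀ᵢ ∃R⁻.(Bᵢ ∧ Cᵢ).  There are 2ⁿ queries that
-- choose Bᵢ or Cᵢ for every i and also provide, for every i, an R-successor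
-- with a predecessor satisfying Bⱼ ∧ Cⱼ for all j ≠ i.  None of them entails q
-- but any two of them together do, so no member of a split partner of {q}
-- satisfies two of them.

open import Data.Bool as Bool using (Bool; false; not; _∨_; if_then_else_)
open import Data.Empty using (⊥; ⊥-elim)
open import Data.Fin using (Fin; zero; suc; #_; toℕ; fromℕ; fromℕ<; inject₁; combine; finToFun; funToFin)
import Data.Fin.Properties as Fin
open import Data.Fin.Relation.Unary.Top using (view; ‵fromℕ; ‵inject₁)
open import Data.List using (List; []; _∷_; _++_; map; length; filter)
open import Data.List.Membership.Propositional using (_∈_; find; lose)
open import Data.List.Membership.Propositional.Properties
  using (∈-++⁺ˡ; ∈-++⁺ʳ; ∈-++⁻; ∈-filter⁺; ∈-filter⁻; ∈-lookup)
open import Data.List.Properties using (map-++; filter-accept; filter-reject)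
open import Data.List.Relation.Binary.Subset.Propositional using (_⊆_)
open import Data.List.Relation.Unary.All as All using (All; []; _∷_)
import Data.List.Relation.Unary.All.Properties as All
open import Data.List.Relation.Unary.Any as Any using (Any; any?; here; there)
import Data.List.Relation.Unary.Any.Properties as Any
open import Data.Maybe using (Maybe; just; nothing)
open import Data.Nat
open import Data.Nat.ListAction using (sum)
open import Data.Nat.ListAction.Properties using (sum-++)
open import Data.Nat.Properties
open import Data.Nat.Tactic.RingSolver using (solve-∀)
open import Data.Product using (∃-syntax; _×_; _,_; proj₁; proj₂)
open import Data.Sum using (_⊎_; inj₁; inj₂)
open import Data.Unit using (⊤; tt)
open import Data.Vec using (Vec; []; _∷_; lookup)
import Data.Vec.Relation.Unary.All as V
import Data.Vec.Relation.Unary.All.Properties as V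
open import Function using (it; _∘_)
open import Function.Bundles using (mk⇔; Equivalence)
open import Relation.Binary.Definitions using (DecidableEquality)
open import Relation.Binary.PropositionalEquality
open import Relation.Nullary using (¬_; Dec; does; _because_; yes; no)
open import Relation.Nullary.Decidable
  using (True; map′; _×-dec_; ¬?; decidable-stable; ¬¬-excluded-middle)
open import Relation.Nullary.Reflects using (Reflects; ofʸ; ofⁿ)
open import Relation.Unary using (Decidable)
open import Defs

-- The point belonging to q′ depends on which subqueries q′ entails, and entailment ranges over all
-- instances and is not decided. Points are therefore only shown to exist under a double negation,
-- which is removed at the end because satisfaction in a finite list of instances is decidable. One
-- enumeration serves both languages: from each of several pools at most one element is taken. In EL
-- every query of Q gives one pool, its subqueries, so that with boundedly many queries there are
-- polynomially many points. In ELI every subquery is a pool of its own, which gives all sets. Only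
-- this enumeration can exceed polynomial size, so the cost of the program is first bounded by a
-- polynomial in the sizes of the input and of the enumeration. For recursive functions the obstacle
-- is that a polynomial bound applied anew at every level would compound. Hence a bound on all
-- outputs is proved beforehand from their meaning, and only the cost is summed along the recursion.

variable
  k n i j : ℕ
  A X Y : Set
  x y : X
  Σ : Signature
  L : Language

-- Bounds of the form (2 + N) ^ d are closed under sums, products and
-- composition, so that a polynomial bound is determined by its degree d.
opaque
  pw : ℕ → ℕ → ℕ
  pw d N = (2 + N) ^ d

  1≤pw : ∀ d N → 1 ≤ pw d N
  1≤pw d N = m^n>0 (2 + N) d

  pw-mono : ∀ d {M N} → M ≤ N → pw d M ≤ pw d N
  pw-mono d M≤N = ^-monoˡ-≤ d (+-monoʳ-≤ 2 M≤N)

  pw-monoʳ : ∀ N {d e} → d ≤ e → pw d N ≤ pw e N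
  pw-monoʳ N d≤e = ^-monoʳ-≤ (2 + N) d≤e

  ≤pw₁ : ∀ N → N ≤ pw 1 N
  ≤pw₁ N = ≤-trans (m≤n+m N 2) (≤-reflexive (sym (*-identityʳ (2 + N))))

  pw-* : ∀ {d e a b} N → a ≤ pw d N → b ≤ pw e N → a * b ≤ pw (d + e) N
  pw-* {d} {e} N p q =
    ≤-trans (*-mono-≤ p q) (≤-reflexive (sym (^-distribˡ-+-* (2 + N) d e)))

  -- Powers are positive, so each is at most their product; the factor 2 that remains is absorbed by
  -- the base, which is at least 2.
  pw-+ : ∀ {d e a b} N → a ≤ pw d N → b ≤ pw e N → a + b ≤ pw (1 + (d + e)) N
  pw-+ {d} {e} {a} {b} N p q = begin
    a + b                              ≤⟨ +-mono-≤ p q ⟩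
    pw d N + pw e N                    ≤⟨ +-mono-≤ (m≤m*n (pw d N) (pw e N) ⦃ >-nonZero (1≤pw e N) ⦄)
                                                   (m≤n*m (pw e N) (pw d N) ⦃ >-nonZero (1≤pw d N) ⦄) ⟩
    r + r                              ≡⟨ cong (r +_) (sym (+-identityʳ r)) ⟩
    2 * r                              ≤⟨ *-mono-≤ {2} {2 + N} (m≤m+n 2 N)
                                            (≤-reflexive (sym (^-distribˡ-+-* (2 + N) d e))) ⟩
    pw (1 + (d + e)) N                 ∎
    where
    open ≤-Reasoning
    r : ℕ
    r = pw d N * pw e N

  pw-∘ : ∀ {d e a b} N → a ≤ pw d b → b ≤ pw e N → a ≤ pw ((2 + e) * d) N
  pw-∘ {d} {e} {a} {b} N p q = begin
    a                          ≤⟨ p ⟩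
    (2 + b) ^ d                ≤⟨ ^-monoˡ-≤ d lemma ⟩
    ((2 + N) ^ (2 + e)) ^ d    ≡⟨ ^-*-assoc (2 + N) (2 + e) d ⟩
    pw ((2 + e) * d) N         ∎
    where
    open ≤-Reasoning
    lemma : 2 + b ≤ pw (2 + e) N
    lemma = pw-+ {1} {e} N (≤-trans (m≤m+n 2 N) (≤-reflexive (sym (*-identityʳ (2 + N))))) q

  2+≤pw₁ : ∀ N → 2 + N ≤ pw 1 N
  2+≤pw₁ N = ≤-reflexive (sym (*-identityʳ (2 + N)))

  pw-suc : ∀ d N → pw (1 + d) N ≡ (2 + N) * pw d N
  pw-suc d N = refl

  pw-def : ∀ d N → pw d N ≡ (2 + N) ^ d
  pw-def d N = refl

  x≤pw-suc : ∀ d N → N ≤ pw (1 + d) N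
  x≤pw-suc d N = ≤-trans (m≤n+m N 2) (m≤m*n (2 + N) (pw d N) ⦃ >-nonZero (1≤pw d N) ⦄)

-- Cost of programs

caseT : {A : Set} → Tree → A → (Tree → Tree → A) → A
caseT leaf       a f = a
caseT (node s t) a f = f s t

-- Functions of two arguments receive `node ctx x` and recur on `x`. Counting `ctx` would spoil the
-- comparison of the summed ranks of several recursive calls with the rank of the caller, since each
-- call carries a context.
rank : Tree → ℕ
rank leaf       = 1
rank (node _ t) = treeSize t

treeSize>0 : ∀ t → 1 ≤ treeSize t
treeSize>0 leaf       = s≤s z≤n
treeSize>0 (node _ _) = s≤s z≤n

rank≤size : ∀ t → rank t ≤ treeSize t
rank≤size leaf       = ≤-refl
rank≤size (node s t) = ≤-trans (m≤n+m (treeSize t) (treeSize s)) (n≤1+n _)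

left≤ : ∀ s t → treeSize s ≤ treeSize (node s t)
left≤ s t = ≤-trans (m≤m+n _ _) (n≤1+n _)

right≤ : ∀ s t → treeSize t ≤ treeSize (node s t)
right≤ s t = ≤-trans (m≤n+m _ _) (n≤1+n _)

module _ {k} {body : Fin k → Exp k 1} where

  -- Whichever rule built or copied the output charged its full size. So a cost bound for a function
  -- is also an output bound.
  size≤cost : ∀ {n} {ρ : Vec Tree n} {e v c} → body ∣ ρ ⊢ e ⇓ v ⟨ c ⟩ → treeSize v ≤ c
  size≤cost ⇓var = ≤-refl
  size≤cost ⇓leaf = ≤-refl
  size≤cost (⇓node {c₁ = c₁} {c₂} d₁ d₂) = m≤n+m _ (c₁ + c₂)
  size≤cost (⇓case-leaf {c = c} {c₁} d₁ d₂) =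
    ≤-trans (size≤cost d₂) (≤-trans (m≤n+m c₁ c) (m≤m+n (c + c₁) 1))
  size≤cost (⇓case-node {c = c} {c₂} d₁ d₂) =
    ≤-trans (size≤cost d₂) (≤-trans (m≤n+m c₂ c) (m≤m+n (c + c₂) 1))
  size≤cost (⇓bind {c₁ = c} {c₂} d₁ d₂) =
    ≤-trans (size≤cost d₂) (≤-trans (m≤n+m c₂ c) (m≤m+n (c + c₂) 1))
  size≤cost (⇓call {c₁ = c} {c₂} d₁ d₂) =
    ≤-trans (size≤cost d₂) (≤-trans (m≤n+m c₂ c) (m≤m+n (c + c₂) 1))

module Machine {k : ℕ} (body : Fin k → Exp k 1) (sem : Fin k → Tree → Tree) where

  val : Exp k n → Vec Tree n → Tree
  val (var i)      ρ = lookup ρ i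
  val leaf         ρ = leaf
  val (node a b)   ρ = node (val a ρ) (val b ρ)
  val (case e a b) ρ = caseT (val e ρ) (val a ρ) (λ s t → val b (s ∷ t ∷ ρ))
  val (bind a b)   ρ = val b (val a ρ ∷ ρ)
  val (call f e)   ρ = sem f (val e ρ)

  Runs : Fin k → Tree → ℕ → Set
  Runs f t C = ∃[ c ] ((body ∣ t ∷ [] ⊢ body f ⇓ sem f t ⟨ c ⟩) × c ≤ C)

  record Good (f : Fin k) : Set where
    field
      degree : ℕ
      runs   : ∀ t → Runs f t (pw degree (treeSize t))

  open Good

  -- `s` is the function whose body is examined: calls of it are merely recorded, by `recs`, while
  -- every other called function must already be `Good`. `closed` embeds an expression without
  -- recorded calls.
  data Ok (s : Maybe (Fin k)) : Exp k n → Set where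
    var  : ∀ {i : Fin n} → Ok s (var i)
    leaf : Ok s (leaf {n = n})
    node : ∀ {a b : Exp k n} → ⦃ Ok s a ⦄ → ⦃ Ok s b ⦄ → Ok s (node a b)
    case : ∀ {e a : Exp k n} {b} → ⦃ Ok s e ⦄ → ⦃ Ok s a ⦄ → ⦃ Ok s b ⦄ → Ok s (case e a b)
    bind : ∀ {a : Exp k n} {b} → ⦃ Ok s a ⦄ → ⦃ Ok s b ⦄ → Ok s (bind a b)
    call : ∀ {f} {e : Exp k n} → ⦃ Good f ⦄ → ⦃ Ok s e ⦄ → Ok s (call f e)
    self   : ∀ {f} {e : Exp k n} → s ≡ just f → Ok s e → Ok s (call f e)
    closed : ∀ {e : Exp k n} → Ok nothing e → Ok s e

  -- The arguments of the calls of f made in evaluating e, where s = just f.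
  recs : ∀ {s} {e : Exp k n} → Ok s e → Vec Tree n → List Tree
  recs var ρ = []
  recs leaf ρ = []
  recs (node ⦃ a ⦄ ⦃ b ⦄) ρ = recs a ρ ++ recs b ρ
  recs (case {e = e} ⦃ o ⦄ ⦃ a ⦄ ⦃ b ⦄) ρ =
    recs o ρ ++ caseT (val e ρ) (recs a ρ) (λ s t → recs b (s ∷ t ∷ ρ))
  recs (bind {a = a} ⦃ o ⦄ ⦃ p ⦄) ρ = recs o ρ ++ recs p (val a ρ ∷ ρ)
  recs (call ⦃ _ ⦄ ⦃ o ⦄) ρ = recs o ρ
  recs (self {e = e} _ o) ρ = recs o ρ ++ val e ρ ∷ []
  recs (closed _) ρ = []

  -- Degree of the value, provided that recursive calls return at most `N`; hence 1 for `self`.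
  -- Under a binder the environment is bounded only by `pw (1 + vdeg o) N`, and composition with
  -- this bound gives the factor `3 + vdeg o`.
  vdeg : ∀ {s} {e : Exp k n} → Ok s e → ℕ
  vdeg var = 1
  vdeg leaf = 0
  vdeg (node ⦃ a ⦄ ⦃ b ⦄) = 1 + (0 + (1 + (vdeg a + vdeg b)))
  vdeg (case ⦃ o ⦄ ⦃ a ⦄ ⦃ b ⦄) = vdeg a + (3 + vdeg o) * vdeg b
  vdeg (bind ⦃ o ⦄ ⦃ b ⦄) = (3 + vdeg o) * vdeg b
  vdeg (call ⦃ g ⦄ ⦃ o ⦄) = (2 + vdeg o) * degree g
  vdeg (self _ o) = 1
  vdeg (closed o) = vdeg o

  -- Degree of the cost apart from the recursive calls, whose costs `evals` adds as a sum over
  -- `recs`.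
  cdeg : ∀ {s} {e : Exp k n} → Ok s e → ℕ
  cdeg var = 1
  cdeg leaf = 0
  cdeg o@(node ⦃ a ⦄ ⦃ b ⦄) = 1 + ((1 + (cdeg a + cdeg b)) + vdeg o)
  cdeg (case ⦃ o ⦄ ⦃ a ⦄ ⦃ b ⦄) =
    1 + ((1 + (cdeg o + (cdeg a + (3 + vdeg o) * cdeg b))) + 0)
  cdeg (bind ⦃ o ⦄ ⦃ b ⦄) = 1 + ((1 + (cdeg o + (3 + vdeg o) * cdeg b)) + 0)
  cdeg (call ⦃ g ⦄ ⦃ o ⦄) = 1 + ((1 + (cdeg o + (2 + vdeg o) * degree g)) + 0)
  cdeg (self _ o) = 1 + (cdeg o + 0)
  cdeg (closed o) = cdeg o

  recs-nothing : ∀ {e : Exp k n} (o : Ok nothing e) ρ → recs o ρ ≡ []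
  recs-nothing var ρ = refl
  recs-nothing leaf ρ = refl
  recs-nothing (node ⦃ a ⦄ ⦃ b ⦄) ρ = cong₂ _++_ (recs-nothing a ρ) (recs-nothing b ρ)
  recs-nothing (case {e = e} ⦃ o ⦄ ⦃ a ⦄ ⦃ b ⦄) ρ =
    cong₂ _++_ (recs-nothing o ρ) (branch (val e ρ))
    where
    branch : ∀ t → caseT t (recs a ρ) (λ s t → recs b (s ∷ t ∷ ρ)) ≡ []
    branch leaf       = recs-nothing a ρ
    branch (node s t) = recs-nothing b (s ∷ t ∷ ρ)
  recs-nothing (bind ⦃ a ⦄ ⦃ b ⦄) ρ = cong₂ _++_ (recs-nothing a ρ) (recs-nothing b _)
  recs-nothing (call ⦃ _ ⦄ ⦃ o ⦄) ρ = recs-nothing o ρ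
  recs-nothing (closed _) ρ = refl

  Small : ℕ → Vec Tree n → Set
  Small N = V.All (λ t → treeSize t ≤ N)

  relax : ∀ {M N} {ρ : Vec Tree n} → M ≤ N → Small M ρ → Small N ρ
  relax M≤N = V.map (λ p → ≤-trans p M≤N)

  good-size : ∀ {f} (g : Good f) t → treeSize (sem f t) ≤ pw (degree g) (treeSize t)
  good-size g t with runs g t
  ... | _ , d , c≤ = ≤-trans (size≤cost d) c≤

  -- The degree is `1 + d` because `pw 0 N` is 1 and would not bound the old environment.
  extend : ∀ {d N t} {ρ : Vec Tree n} → treeSize t ≤ pw d N → Small N ρ → Small (pw (1 + d) N) (t ∷ ρ)
  extend {d = d} {N} p q = ≤-trans p (pw-monoʳ N (n≤1+n d)) V.∷ relax (x≤pw-suc d N) q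

  extend₂ : ∀ {d N s t} {ρ : Vec Tree n} → treeSize (node s t) ≤ pw d N → Small N ρ →
            Small (pw (1 + d) N) (s ∷ t ∷ ρ)
  extend₂ {d = d} {N} {s} {t} p q =
    ≤-trans (≤-trans (left≤ s t) p) (pw-monoʳ N (n≤1+n d))
         V.∷ extend {d = d} (≤-trans (right≤ s t) p) q

  Outputs≤ : Maybe (Fin k) → ℕ → List Tree → Set
  Outputs≤ s N ts = ∀ {f} → s ≡ just f → All (λ t → treeSize (sem f t) ≤ N) ts

  outputs-relax : ∀ {s M N ts} → M ≤ N → Outputs≤ s M ts → Outputs≤ s N ts
  outputs-relax M≤N h eq = All.map (λ p → ≤-trans p M≤N) (h eq)

  val-size : ∀ {s} {e : Exp k n} (o : Ok s e) N {ρ} → Small N ρ → Outputs≤ s N (recs o ρ) →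
             treeSize (val e ρ) ≤ pw (vdeg o) N
  val-size (var {i = i}) N small h = ≤-trans (V.lookup⁺ small i) (≤pw₁ N)
  val-size leaf N small h = 1≤pw 0 N
  val-size (node ⦃ a ⦄ ⦃ b ⦄) N {ρ} small h =
    pw-+ {0} N (1≤pw 0 N) (pw-+ N (val-size a N small (λ eq → All.++⁻ˡ (recs a ρ) (h eq)))
                              (val-size b N small (λ eq → All.++⁻ʳ (recs a ρ) (h eq))))
  val-size {s = s′} (case {e = e} {a} {b} ⦃ o ⦄ ⦃ p ⦄ ⦃ q ⦄) N {ρ} small h =
    branch (val e ρ) (val-size o N small (λ eq → All.++⁻ˡ (recs o ρ) (h eq)))
                     (λ eq → All.++⁻ʳ (recs o ρ) (h eq))
    where
    branch : ∀ t → treeSize t ≤ pw (vdeg o) N →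
             Outputs≤ s′ N (caseT t (recs p ρ) (λ s t → recs q (s ∷ t ∷ ρ))) →
             treeSize (caseT t (val a ρ) (λ s t → val b (s ∷ t ∷ ρ))) ≤ pw (vdeg p + (3 + vdeg o) * vdeg q) N
    branch leaf t≤ h = ≤-trans (val-size p N small h) (pw-monoʳ N (m≤m+n _ _))
    branch (node s t) t≤ h =
      ≤-trans (pw-∘ {e = 1 + vdeg o} N (val-size q _ (extend₂ {d = vdeg o} t≤ small)
                                            (outputs-relax (x≤pw-suc (vdeg o) N) h)) ≤-refl)
              (pw-monoʳ N (m≤n+m _ (vdeg p)))
  val-size (bind {a = a} ⦃ o ⦄ ⦃ q ⦄) N {ρ} small h =
    pw-∘ {e = 1 + vdeg o} N
      (val-size q _ (extend {d = vdeg o} (val-size o N small (λ eq → All.++⁻ˡ (recs o ρ) (h eq))) small)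
                (outputs-relax (x≤pw-suc (vdeg o) N) (λ eq → All.++⁻ʳ (recs o ρ) (h eq))))
      ≤-refl
  val-size (call ⦃ g ⦄ ⦃ o ⦄) N small h = pw-∘ N (good-size g _) (val-size o N small h)
  val-size (self {e = e} eq o) N {ρ} small h with All.++⁻ʳ (recs o ρ) (h eq)
  ... | p ∷ [] = ≤-trans p (≤pw₁ N)
  val-size (closed o) N {ρ} small h =
    val-size o N small (λ ())

  Calls : Maybe (Fin k) → (Tree → ℕ) → List Tree → Set
  Calls s C ts = ∀ {f} → s ≡ just f → All (λ t → Runs f t (C t)) ts

  ∑ : (Tree → ℕ) → List Tree → ℕ
  ∑ C ts = sum (map C ts)

  ∑-++ : ∀ C ts us → ∑ C (ts ++ us) ≡ ∑ C ts + ∑ C us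
  ∑-++ C ts us = trans (cong sum (map-++ C ts us)) (sum-++ (map C ts) (map C us))

  split-∑ : ∀ {c X} C ts us → c ≤ X + (∑ C ts + ∑ C us) → c ≤ X + ∑ C (ts ++ us)
  split-∑ {c} {X} C ts us = subst (λ y → c ≤ X + y) (sym (∑-++ C ts us))

  add-costs : ∀ {c₁ c₂ c₃ d₁ d₂ d₃ R₁ R₂} N → c₁ ≤ pw d₁ N + R₁ → c₂ ≤ pw d₂ N + R₂ → c₃ ≤ pw d₃ N →
         c₁ + c₂ + c₃ ≤ pw (1 + ((1 + (d₁ + d₂)) + d₃)) N + (R₁ + R₂)
  add-costs {c₁} {c₂} {c₃} {d₁} {d₂} {d₃} {R₁} {R₂} N p q r = begin
    c₁ + c₂ + c₃                              ≤⟨ +-mono-≤ (+-mono-≤ p q) r ⟩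
    ((pw d₁ N + R₁) + (pw d₂ N + R₂)) + pw d₃ N ≡⟨ rearrange (pw d₁ N) R₁ (pw d₂ N) R₂ (pw d₃ N) ⟩
    (pw d₁ N + pw d₂ N + pw d₃ N) + (R₁ + R₂) ≤⟨ +-monoˡ-≤ (R₁ + R₂) (pw-+ {1 + (d₁ + d₂)} {d₃} N (pw-+ {d₁} {d₂} N ≤-refl ≤-refl) ≤-refl) ⟩
    _ ∎
    where
    open ≤-Reasoning
    rearrange : ∀ a b c d e → ((a + b) + (c + d)) + e ≡ (a + c + e) + (b + d)
    rearrange = solve-∀

  Evals : Exp k n → Vec Tree n → ℕ → Set
  Evals e ρ C = ∃[ c ] ((body ∣ ρ ⊢ e ⇓ val e ρ ⟨ c ⟩) × c ≤ C)

  evals : ∀ {s} {e : Exp k n} (o : Ok s e) N {ρ} C → Small N ρ →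
          Outputs≤ s N (recs o ρ) → Calls s C (recs o ρ) →
          Evals e ρ (pw (cdeg o) N + ∑ C (recs o ρ))
  evals (var {i = i}) N C small h _ =
    _ , ⇓var , ≤-trans (V.lookup⁺ small i) (≤-trans (≤pw₁ N) (m≤m+n _ 0))
  evals leaf N C small h _ = _ , ⇓leaf , ≤-trans (1≤pw 0 N) (m≤m+n _ 0)
  evals o@(node ⦃ a ⦄ ⦃ b ⦄) N {ρ} C small h r
    with evals a N C small (λ eq → All.++⁻ˡ (recs a ρ) (h eq)) (λ eq → All.++⁻ˡ (recs a ρ) (r eq))
       | evals b N C small (λ eq → All.++⁻ʳ (recs a ρ) (h eq)) (λ eq → All.++⁻ʳ (recs a ρ) (r eq))
  ... | c , d , c≤ | c′ , d′ , c′≤ =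
    _ , ⇓node d d′ , split-∑ C (recs a ρ) (recs b ρ)
                           (add-costs {d₁ = cdeg a} {cdeg b} {vdeg o} N c≤ c′≤ (val-size o N small h))
  evals {s = s′} (case {e = e} {a} {b} ⦃ o ⦄ ⦃ p ⦄ ⦃ q ⦄) N {ρ} C small h r
    with evals o N C small (λ eq → All.++⁻ˡ (recs o ρ) (h eq)) (λ eq → All.++⁻ˡ (recs o ρ) (r eq))
  ... | c , d , c≤ =
    branch (val e ρ) refl (val-size o N small (λ eq → All.++⁻ˡ (recs o ρ) (h eq)))
                     (λ eq → All.++⁻ʳ (recs o ρ) (h eq))
                     (λ eq → All.++⁻ʳ (recs o ρ) (r eq))
    where
    D = cdeg p + (3 + vdeg o) * cdeg q
    branch : ∀ t → val e ρ ≡ t → treeSize t ≤ pw (vdeg o) N →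
             let rs = caseT t (recs p ρ) (λ s t → recs q (s ∷ t ∷ ρ)) in
             Outputs≤ s′ N rs → Calls s′ C rs →
             ∃[ c ] ((body ∣ ρ ⊢ case e a b ⇓ caseT t (val a ρ) (λ s t → val b (s ∷ t ∷ ρ)) ⟨ c ⟩)
                    × c ≤ pw (1 + ((1 + (cdeg o + D)) + 0)) N + ∑ C (recs o ρ ++ rs))
    branch leaf eq t≤ h r with evals p N C small h r
    ... | c′ , d′ , c′≤ =
      _ , ⇓case-leaf (subst (λ t → body ∣ ρ ⊢ e ⇓ t ⟨ c ⟩) eq d) d′
        , split-∑ C (recs o ρ) (recs p ρ)
            (add-costs {d₁ = cdeg o} {D} {0} N c≤ (≤-trans c′≤ (+-monoˡ-≤ _ (pw-monoʳ N (m≤m+n _ _)))) (1≤pw 0 N))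
    branch (node s t) eq t≤ h r
      with evals q _ C (extend₂ {d = vdeg o} t≤ small) (outputs-relax (x≤pw-suc (vdeg o) N) h) r
    ... | c′ , d′ , c′≤ =
      _ , ⇓case-node (subst (λ t → body ∣ ρ ⊢ e ⇓ t ⟨ c ⟩) eq d) d′
        , split-∑ C (recs o ρ) _
            (add-costs {d₁ = cdeg o} {D} {0} N c≤
               (≤-trans c′≤ (+-monoˡ-≤ _ (≤-trans (pw-∘ {cdeg q} {1 + vdeg o} N ≤-refl ≤-refl)
                                                  (pw-monoʳ N (m≤n+m _ (cdeg p)))))) (1≤pw 0 N))
  evals (bind {a = a} ⦃ o ⦄ ⦃ q ⦄) N {ρ} C small h r
    with evals o N C small (λ eq → All.++⁻ˡ (recs o ρ) (h eq)) (λ eq → All.++⁻ˡ (recs o ρ) (r eq))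
       | evals q _ C (extend {d = vdeg o} (val-size o N small (λ eq → All.++⁻ˡ (recs o ρ) (h eq))) small)
                   (outputs-relax (x≤pw-suc (vdeg o) N) (λ eq → All.++⁻ʳ (recs o ρ) (h eq)))
                   (λ eq → All.++⁻ʳ (recs o ρ) (r eq))
  ... | c , d , c≤ | c′ , d′ , c′≤ =
    _ , ⇓bind d d′
      , split-∑ C (recs o ρ) _
          (add-costs {d₁ = cdeg o} {(3 + vdeg o) * cdeg q} {0} N c≤
             (≤-trans c′≤ (+-monoˡ-≤ _ (pw-∘ {cdeg q} {1 + vdeg o} N ≤-refl ≤-refl))) (1≤pw 0 N))
  evals (call {e = e} ⦃ g ⦄ ⦃ o ⦄) N {ρ} C small h r
    with evals o N C small h r | runs g (val e ρ)
  ... | c , d , c≤ | c′ , d′ , c′≤ =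
    _ , ⇓call d d′
      , ≤-trans (add-costs {d₁ = cdeg o} {(2 + vdeg o) * degree g} {0} {R₂ = 0} N c≤
             (≤-trans c′≤ (≤-trans (pw-∘ {degree g} {vdeg o} N ≤-refl (val-size o N small h))
                                   (m≤m+n _ 0))) (1≤pw 0 N))
          (+-monoʳ-≤ (pw (cdeg (call ⦃ g ⦄ ⦃ o ⦄)) N) (≤-reflexive (+-identityʳ (∑ C (recs o ρ)))))
  evals (self {e = e} eq o) N {ρ} C small h r
    with evals o N C small (λ eq → All.++⁻ˡ (recs o ρ) (h eq)) (λ eq → All.++⁻ˡ (recs o ρ) (r eq))
       | All.++⁻ʳ (recs o ρ) (r eq)
  ... | c , d , c≤ | (c′ , d′ , c′≤) ∷ [] = _ , ⇓call d d′ , bound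
    where
    open ≤-Reasoning
    R = ∑ C (recs o ρ)
    rearrange : ∀ a b c → a + b + c + 1 ≡ (a + 1) + (b + (c + 0))
    rearrange = solve-∀
    bound : c + c′ + 1 ≤ pw (1 + (cdeg o + 0)) N + ∑ C (recs o ρ ++ val e ρ ∷ [])
    bound = begin
      c + c′ + 1                               ≤⟨ +-monoˡ-≤ 1 (+-mono-≤ c≤ c′≤) ⟩
      pw (cdeg o) N + R + C (val e ρ) + 1      ≡⟨ rearrange (pw (cdeg o) N) R (C (val e ρ)) ⟩
      (pw (cdeg o) N + 1) + (R + (C (val e ρ) + 0)) ≤⟨ +-mono-≤ (pw-+ {cdeg o} {0} N ≤-refl (1≤pw 0 N))
                                                         (≤-reflexive (sym (∑-++ C (recs o ρ) (val e ρ ∷ [])))) ⟩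
      _ ∎
  evals (closed o) N {ρ} C small h _
    with evals o N C small (λ ()) (λ ())
  ... | c , d , c≤ = c , d , subst (λ ts → c ≤ pw (cdeg o) N + ∑ C ts) (recs-nothing o ρ) c≤

  eval-closed : {e : Exp k n} (o : Ok nothing e) → ∀ N {ρ} → Small N ρ → Evals e ρ (pw (cdeg o) N)
  eval-closed o N {ρ} small with evals o N (λ _ → 0) small (λ ()) (λ ())
  ... | c , d , c≤ = c , d , subst (c ≤_) (+-identityʳ _)
                       (subst (λ ts → c ≤ pw (cdeg o) N + ∑ (λ _ → 0) ts) (recs-nothing o ρ) c≤)

  -- Every call costs at most `pw (cdeg o) N` besides its own recursive calls. Here `N` bounds all
  -- arguments and outputs of the whole recursion at once, and `Adm N t` says that it does so from
  -- the argument `t` on.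
  module Recursion
    (f : Fin k) {e : Exp k 1} (body-f : body f ≡ e) (o : Ok (just f) e)
    (correct : ∀ t → val e (t ∷ []) ≡ sem f t)
    (Adm : ℕ → Tree → Set)
    (adm-size : ∀ {N} t → Adm N t → treeSize t ≤ N)
    (adm-recs : ∀ {N} t → Adm N t →
                All (λ s → Adm N s × treeSize (sem f s) ≤ N) (recs o (t ∷ [])))
    -- Hence at most rank t calls are made in all.
    (decreasing : ∀ t → sum (map rank (recs o (t ∷ []))) < rank t)
    where

    ∑-* : ∀ c ts → ∑ (λ s → rank s * c) ts ≡ sum (map rank ts) * c
    ∑-* c [] = refl
    ∑-* c (t ∷ ts) = trans (cong (rank t * c +_) (∑-* c ts)) (sym (*-distribʳ-+ c (rank t) _))

    run : ∀ N m t → rank t ≤ m → Adm N t → Runs f t (rank t * pw (cdeg o) N)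
    run N zero t t≤ adm with ≤-trans (≤-trans (s≤s z≤n) (decreasing t)) t≤
    ... | ()
    run N (suc m) t t≤ adm
      with evals o N (λ s → rank s * pw (cdeg o) N) (adm-size t adm V.∷ V.[])
             (λ { refl → All.map proj₂ (adm-recs t adm) })
             (λ { refl → subcalls _ (adm-recs t adm) (≤-pred (≤-trans (decreasing t) t≤)) })
      where
      subcalls : ∀ ts → All (λ s → Adm N s × treeSize (sem f s) ≤ N) ts → sum (map rank ts) ≤ m →
                 All (λ s → Runs f s (rank s * pw (cdeg o) N)) ts
      subcalls [] [] _ = []
      subcalls (s ∷ ts) (a ∷ as) p =
        run N m s (≤-trans (m≤m+n _ _) p) (proj₁ a) ∷ subcalls ts as (≤-trans (m≤n+m _ (rank s)) p)
    ... | c , d , c≤ = c , subst₂ (λ e v → body ∣ t ∷ [] ⊢ e ⇓ v ⟨ c ⟩) (sym body-f) (correct t) d , bound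
      where
      open ≤-Reasoning
      bound : c ≤ rank t * pw (cdeg o) N
      bound = begin
        c ≤⟨ c≤ ⟩
        pw (cdeg o) N + ∑ (λ s → rank s * pw (cdeg o) N) (recs o (t ∷ []))
          ≡⟨ cong (pw (cdeg o) N +_) (∑-* (pw (cdeg o) N) (recs o (t ∷ []))) ⟩
        suc (sum (map rank (recs o (t ∷ [])))) * pw (cdeg o) N
          ≤⟨ *-monoˡ-≤ (pw (cdeg o) N) (decreasing t) ⟩
        rank t * pw (cdeg o) N ∎

  good-rec : (f : Fin k) {e : Exp k 1} → body f ≡ e → (o : Ok (just f) e) →
             (∀ t → val e (t ∷ []) ≡ sem f t) →
             ∀ d → (∀ t → treeSize (sem f t) ≤ pw d (treeSize t)) →
             (∀ t → All (λ s → treeSize s ≤ treeSize t) (recs o (t ∷ []))) →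
             (∀ t → sum (map rank (recs o (t ∷ []))) < rank t) →
             Good f
  good-rec f body-f o correct d out≤ recs≤ decreasing = record
    -- The 1 is for the factor `rank t`; the rest composes `cdeg o` with the uniform bound
    -- `pw (1 + d) (treeSize t)`, which covers the arguments as well as the outputs.
    { degree = 1 + (2 + (1 + d)) * cdeg o
    ; runs = λ t → let c , der , c≤ = R.run (pw (1 + d) (treeSize t)) (rank t) t ≤-refl ≤-refl in
               c , der , ≤-trans c≤ (pw-* {1} {(2 + (1 + d)) * cdeg o} (treeSize t)
                           (≤-trans (rank≤size t) (≤pw₁ _))
                           (pw-∘ {cdeg o} {1 + d} (treeSize t) ≤-refl ≤-refl)) }
    where
    Adm : ℕ → Tree → Set
    Adm N t = pw (1 + d) (treeSize t) ≤ N
    adm-size : ∀ {N} t → Adm N t → treeSize t ≤ N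
    adm-size t p = ≤-trans (x≤pw-suc d (treeSize t)) p
    adm-recs : ∀ {N} t → Adm N t → All (λ s → Adm N s × treeSize (sem f s) ≤ N) (recs o (t ∷ []))
    adm-recs t p = All.map (λ {s} s≤ → ≤-trans (pw-mono (1 + d) s≤) p
                             , ≤-trans (out≤ s) (≤-trans (pw-mono d s≤) (≤-trans (pw-monoʳ _ (n≤1+n d)) p)))
                           (recs≤ t)
    module R = Recursion f body-f o correct Adm adm-size adm-recs decreasing

appT : Tree → Tree → Tree
appT leaf       m = m
appT (node x l) m = node x (appT l m)

-- Trees in the role of lists; xs is what follows the element x and thus
-- determines its index.
gatherT : (Tree → Tree → Tree → Tree) → Tree → Tree → Tree
gatherT g ctx leaf        = leaf
gatherT g ctx (node x xs) = appT (g ctx x xs) (gatherT g ctx xs)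

size-appT : ∀ l m → treeSize (appT l m) ≤ treeSize l + treeSize m
size-appT leaf       m = n≤1+n _
size-appT (node x l) m = s≤s (≤-trans (+-monoʳ-≤ (treeSize x) (size-appT l m))
                                      (≤-reflexive (sym (+-assoc (treeSize x) _ _))))

size-gatherT : ∀ g ctx {B} N → (∀ x xs → treeSize (node x xs) ≤ N → treeSize (g ctx x xs) ≤ B) → 1 ≤ B →
               ∀ l → treeSize l ≤ N → treeSize (gatherT g ctx l) ≤ treeSize l * B
size-gatherT g ctx {B} N g≤ 1≤B leaf l≤ = ≤-trans 1≤B (≤-reflexive (sym (*-identityˡ B)))
size-gatherT g ctx {B} N g≤ 1≤B (node x xs) l≤ = begin
  treeSize (appT (g ctx x xs) (gatherT g ctx xs))          ≤⟨ size-appT (g ctx x xs) _ ⟩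
  treeSize (g ctx x xs) + treeSize (gatherT g ctx xs)      ≤⟨ +-mono-≤ (g≤ x xs l≤) (size-gatherT g ctx N g≤ 1≤B xs
                                                                       (≤-trans (right≤ x xs) l≤)) ⟩
  (1 + treeSize xs) * B                                     ≤⟨ *-monoˡ-≤ B (s≤s (m≤n+m _ (treeSize x))) ⟩
  treeSize (node x xs) * B                                  ∎
  where open ≤-Reasoning

-- In `e` the variables 0, 1 and 2 are the element, the rest of the list and the context.
gatherE : ∀ {k} → Fin k → Fin k → Exp k 5 → Exp k 1
gatherE app f e =
  case (var (# 0)) leaf
    (case (var (# 1)) leaf
      (call app (node (call f (node (var (# 2)) (var (# 1)))) e)))

module Gather {k : ℕ} (body : Fin k → Exp k 1) (sem : Fin k → Tree → Tree)
              (app : Fin k) (sem-app : ∀ l m → sem app (node m l) ≡ appT l m) where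

  open Machine body sem

  env : Tree → Tree → Tree → Vec Tree 5
  env ctx x xs = x ∷ xs ∷ ctx ∷ node x xs ∷ node ctx (node x xs) ∷ []

  -- The only recursive call is on the tail, and the output concatenates at most as many pieces as
  -- the list is large, so its degree exceeds that of a piece by one.
  good-gather : ⦃ Good app ⦄ → ∀ f {e g} ⦃ o : Ok nothing e ⦄ → body f ≡ gatherE app f e →
                (∀ t → sem f t ≡ caseT t leaf (gatherT g)) →
                (∀ ctx x xs → val e (env ctx x xs) ≡ g ctx x xs) → Good f
  good-gather f {e} {g} ⦃ o ⦄ body-f sem-f val-e =
    good-rec f body-f ok correct (1 + vdeg o) out≤ recs≤ decreasing
    where
    ok : Ok (just f) (gatherE app f e)
    ok = case ⦃ var ⦄ ⦃ leaf ⦄ ⦃ case ⦃ var ⦄ ⦃ leaf ⦄ ⦃ call ⦃ it ⦄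
           ⦃ node ⦃ self refl (node ⦃ var ⦄ ⦃ var ⦄) ⦄ ⦃ closed o ⦄ ⦄ ⦄ ⦄

    correct : ∀ t → val (gatherE app f e) (t ∷ []) ≡ sem f t
    correct leaf = sym (sem-f leaf)
    correct (node ctx leaf) = sym (sem-f (node ctx leaf))
    correct (node ctx (node x xs)) = begin
      sem app (node (sem f (node ctx xs)) (val e (env ctx x xs))) ≡⟨ sem-app _ _ ⟩
      appT (val e (env ctx x xs)) (sem f (node ctx xs))           ≡⟨ cong₂ appT (val-e ctx x xs) (sem-f (node ctx xs)) ⟩
      appT (g ctx x xs) (gatherT g ctx xs)                         ≡⟨ sem-f (node ctx (node x xs)) ⟨
      sem f (node ctx (node x xs)) ∎
      where open ≡-Reasoning

    out≤ : ∀ t → treeSize (sem f t) ≤ pw (1 + vdeg o) (treeSize t)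
    out≤ leaf rewrite sem-f leaf = 1≤pw _ _
    out≤ (node ctx l) rewrite sem-f (node ctx l) =
      ≤-trans (size-gatherT g ctx (treeSize l) g≤ (1≤pw (vdeg o) N) l ≤-refl)
              (pw-* {1} {vdeg o} N (≤-trans (right≤ ctx l) (≤pw₁ N)) ≤-refl)
      where
      N = treeSize (node ctx l)
      g≤ : ∀ x xs → treeSize (node x xs) ≤ treeSize l → treeSize (g ctx x xs) ≤ pw (vdeg o) N
      g≤ x xs p = subst (λ t → treeSize t ≤ pw (vdeg o) N) (val-e ctx x xs)
        (val-size o N (≤-trans (left≤ x xs) q V.∷ ≤-trans (right≤ x xs) q V.∷ left≤ ctx l V.∷ q
                       V.∷ s≤s (+-monoʳ-≤ (treeSize ctx) p) V.∷ V.[]) (λ ()))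
        where
        q : treeSize (node x xs) ≤ N
        q = ≤-trans p (right≤ ctx l)

    recs≤ : ∀ t → All (λ s → treeSize s ≤ treeSize t) (recs ok (t ∷ []))
    recs≤ leaf = []
    recs≤ (node ctx leaf) = []
    recs≤ (node ctx (node x xs)) = s≤s (+-monoʳ-≤ (treeSize ctx) (right≤ x xs)) ∷ []

    decreasing : ∀ t → sum (map rank (recs ok (t ∷ []))) < rank t
    decreasing leaf = s≤s z≤n
    decreasing (node ctx leaf) = s≤s z≤n
    decreasing (node ctx (node x xs)) = s≤s (≤-trans (≤-reflexive (+-identityʳ _)) (m≤n+m _ (treeSize x)))

-- The program

-- Falsity is `leaf` and every `node` counts as truth, so `appT` is disjunction and `gatherT` an
-- existential quantifier. The same tree is the number 1 and the list whose only entry is `leaf`.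
pattern true = node leaf leaf

eqT : Tree → Tree → Tree
eqT leaf       leaf       = true
eqT leaf       (node _ _) = leaf
eqT (node _ _) leaf       = leaf
eqT (node a b) (node c d) = caseT (eqT a c) leaf λ _ _ → eqT b d

-- With flag leaf the top-level conjuncts, otherwise all subqueries of an
-- encoded query that are atoms or existential.
collT : Tree → Tree → Tree
collT f leaf = leaf
-- The patterns read the unary tag: 0 for `top`, 1 for `atom`, 2 for `_∧_`, 3 for `some`. Clauses
-- with a `leaf` for the arguments of the last two treat trees that encode nothing.
collT f (node leaf p) = leaf
collT f q@(node (node _ leaf) p) = node q leaf
collT f (node (node _ (node _ leaf)) leaf) = leaf
collT f (node (node _ (node _ leaf)) (node q₁ q₂)) = appT (collT f q₁) (collT f q₂)
collT f q@(node (node _ (node _ (node _ _))) leaf) = node q leaf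
collT leaf q@(node (node _ (node _ (node _ _))) (node S r)) = node q leaf
collT f@(node _ _) q@(node (node _ (node _ (node _ _))) (node S r)) = node q (collT f r)

-- A unary number is a list of that many leaves. So `gatherT` can also run over a number, and what
-- follows its entries are then exactly the smaller numbers.
lenT : Tree → Tree
lenT l = gatherT (λ _ _ _ → true) leaf l

collsT poolT singlesT prepT extT memT refutesT violT concepts₁T conceptsT roles₁T roles₂T rolesT
  missingT pointsT : Tree → Tree → Tree

collsT = gatherT λ flag q _ → node (collT flag q) leaf

poolT = gatherT λ flag q _ → collT flag q

singlesT = gatherT λ _ q _ → node (node q leaf) leaf

prepT = gatherT λ q t _ → node (node q t) leaf

extT = gatherT λ R q _ → prepT q R

-- Here `true` is the list that contains only the empty selection. Selections skipping the pool come
-- first, so the result for the other pools is an initial part of the whole result.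
choicesT : Tree → Tree
choicesT leaf        = true
choicesT (node L Ls) = appT (choicesT Ls) (extT (choicesT Ls) L)

memT = gatherT λ q r _ → eqT q r

refutesT = gatherT λ t r _ → memT r t

conj : Tree → Tree
conj q = collT leaf q

-- The encodings of an existential query have the shape node tag (node S r).
violT = gatherT λ St x _ →
  caseT x leaf λ tag p → caseT p leaf λ S r → caseT St leaf λ S₀ t →
  caseT (eqT (node tag S) (node (encodeℕ 3) S₀)) leaf λ _ _ →
  caseT (refutesT t (conj r)) true λ _ _ → leaf

concepts₁T = gatherT λ ti _ A →
  caseT ti leaf λ t i →
  caseT (memT (node (encodeℕ 1) A) t) (node (node leaf (node A i)) leaf) λ _ _ → leaf

conceptsT = gatherT λ U t ts → concepts₁T (node t (lenT ts)) U

roles₁T = gatherT λ tiuj _ P →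
  caseT tiuj leaf λ ti uj → caseT ti leaf λ t i → caseT uj leaf λ u j →
  caseT (violT (node (node leaf P) u) t)
    (caseT (violT (node (node true P) t) u)
      (node (node true (node P (node i j))) leaf) λ _ _ → leaf)
    λ _ _ → leaf

roles₂T = gatherT λ tiB u us → caseT tiB leaf λ ti B → roles₁T (node ti (node u (lenT us))) B

rolesT = gatherT λ BT t ts → caseT BT leaf λ B T → roles₂T (node (node t (lenT ts)) B) T

missingT = gatherT λ t q _ → caseT (refutesT t (conj q)) true λ _ _ → leaf

pointsT = gatherT λ Q𝒜 t ts → caseT Q𝒜 leaf λ Q 𝒜 →
  caseT (missingT t Q) (node (node 𝒜 (lenT ts)) leaf) λ _ _ → leaf

K : ℕ
K = 20

app eq coll choices len colls pool singles prep ext mem refutes viol concepts₁ concepts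
  roles₁ roles₂ roles missing points : Fin K
app       = # 0
eq        = # 1
coll      = # 2
choices   = # 3
len       = # 4
colls     = # 5
pool      = # 6
singles   = # 7
prep      = # 8
ext       = # 9
mem       = # 10
refutes   = # 11
viol      = # 12
concepts₁ = # 13
concepts  = # 14
roles₁    = # 15
roles₂    = # 16
roles     = # 17
missing   = # 18
points    = # 19

v : ∀ {n} m {m<n : True (m <? n)} → Exp K n
v m {p} = var (#_ m {m<n = p})

call₂ : ∀ {n} → Fin K → Exp K n → Exp K n → Exp K n
call₂ f a b = call f (node a b)

true′ three′ : ∀ {n} → Exp K n
true′  = node leaf leaf
three′ = node leaf (node leaf true′)

conj′ len′ [_]′ : ∀ {n} → Exp K n → Exp K n
conj′ r = call₂ coll leaf r
len′ l = call₂ len leaf l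
[ e ]′ = node e leaf

lenE collsE poolE singlesE prepE extE memE refutesE violE concepts₁E conceptsE roles₁E roles₂E rolesE
  missingE pointsE : Exp K 5
lenE = true′
collsE = [ call₂ coll (v 2) (v 0) ]′
poolE = call₂ coll (v 2) (v 0)
singlesE = [ [ v 0 ]′ ]′
prepE = [ node (v 2) (v 0) ]′
extE = call₂ prep (v 0) (v 2)
memE = call₂ eq (v 2) (v 0)
refutesE = call₂ mem (v 0) (v 2)
violE = case (v 0) leaf (case (v 1) leaf (case (v 6) leaf
  (case (call₂ eq (node (v 4) (v 2)) (node three′ (v 0))) leaf
    (case (call₂ refutes (v 3) (conj′ (v 5))) true′ leaf))))
concepts₁E = case (v 2) leaf
  (case (call₂ mem (node true′ (v 3)) (v 0)) [ node leaf (node (v 3) (v 1)) ]′ leaf)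
conceptsE = call₂ concepts₁ (node (v 0) (len′ (v 1))) (v 2)
roles₁E = case (v 2) leaf (case (v 0) leaf (case (v 3) leaf
  (case (call₂ viol (node (node leaf (v 7)) (v 0)) (v 2))
    (case (call₂ viol (node (node true′ (v 7)) (v 2)) (v 0))
      [ node true′ (node (v 7) (node (v 3) (v 1))) ]′ leaf)
    leaf)))
roles₂E = case (v 2) leaf (call₂ roles₁ (node (v 0) (node (v 2) (len′ (v 3)))) (v 1))
rolesE = case (v 2) leaf (call₂ roles₂ (node (node (v 2) (len′ (v 3))) (v 0)) (v 1))
missingE = case (call₂ refutes (v 2) (conj′ (v 0))) true′ leaf
pointsE = case (v 2) leaf
  (case (call₂ missing (v 2) (v 0)) [ node (v 1) (len′ (v 3)) ]′ leaf)

appE eqE collE choicesE : Exp K 1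
appE = case (v 0) leaf (case (v 1) (v 0) (node (v 0) (call₂ app (v 2) (v 1))))
eqE = case (v 0) leaf (case (v 0)
  (case (v 1) true′ leaf)
  (case (v 3) leaf (case (call₂ eq (v 2) (v 0)) leaf (call₂ eq (v 5) (v 3)))))
collE = case (v 0) leaf (case (v 1) leaf
  (case (v 0) leaf
  (case (v 1) [ v 5 ]′
  (case (v 1)
    (case (v 5) leaf (call₂ app (call₂ coll (v 8) (v 1)) (call₂ coll (v 8) (v 0))))
    (node (v 9) (case (v 7) leaf (case (v 10) leaf (call₂ coll (v 12) (v 3)))))))))
choicesE = case (v 0) leaf (case (v 1) true′
  (bind (call₂ choices (v 2) (v 1)) (call₂ app (call₂ ext (v 0) (v 1)) (v 0))))

-- The recursion theorem measures the right component of the argument, so the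
-- list that app traverses comes second: app (node m l) is l ++ m.
body : Fin K → Exp K 1
body = lookup
  ( appE ∷ eqE ∷ collE ∷ choicesE
  ∷ gatherE app len lenE ∷ gatherE app colls collsE ∷ gatherE app pool poolE
  ∷ gatherE app singles singlesE ∷ gatherE app prep prepE ∷ gatherE app ext extE
  ∷ gatherE app mem memE ∷ gatherE app refutes refutesE ∷ gatherE app viol violE
  ∷ gatherE app concepts₁ concepts₁E ∷ gatherE app concepts conceptsE
  ∷ gatherE app roles₁ roles₁E ∷ gatherE app roles₂ roles₂E ∷ gatherE app roles rolesE
  ∷ gatherE app missing missingE ∷ gatherE app points pointsE ∷ [])

on : (Tree → Tree → Tree) → Tree → Tree
on f t = caseT t leaf f

sem : Fin K → Tree → Tree
sem = lookup
  ( on (λ m l → appT l m) ∷ on eqT ∷ on collT ∷ on (λ _ Ls → choicesT Ls)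
  ∷ on (gatherT λ _ _ _ → true) ∷ on collsT ∷ on poolT ∷ on singlesT ∷ on prepT ∷ on extT ∷ on memT
  ∷ on refutesT ∷ on violT ∷ on concepts₁T ∷ on conceptsT ∷ on roles₁T ∷ on roles₂T ∷ on rolesT
  ∷ on missingT ∷ on pointsT ∷ [])

open Machine body sem public
open Gather body sem app (λ _ _ → refl) public

-- Polynomial cost of the functions of the table

size-eqT : ∀ x y → treeSize (eqT x y) ≤ 3
size-eqT leaf leaf = ≤-refl
size-eqT leaf (node _ _) = s≤s z≤n
size-eqT (node _ _) leaf = s≤s z≤n
size-eqT (node a b) (node c d) with eqT a c
... | leaf     = s≤s z≤n
... | node _ _ = size-eqT b d

module _ {B : ℕ} where

  atomic : ∀ q → 2 + treeSize q ≤ B → treeSize (node q leaf) ≤ treeSize q * B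
  atomic q q≤ = ≤-trans (s≤s (≤-reflexive (+-comm (treeSize q) 1)))
    (≤-trans q≤ (m≤n*m B (treeSize q) ⦃ >-nonZero (treeSize>0 q) ⦄))

  positive : ∀ q → 2 + treeSize q ≤ B → 1 ≤ treeSize q * B
  positive q q≤ = *-mono-≤ (treeSize>0 q) (≤-trans (s≤s z≤n) q≤)

  -- `B` stays fixed while `q` shrinks, so the bound adds up along the recursion: there are at most
  -- `treeSize q` listed subqueries, each paid for by one `B`.
  size-collT : ∀ f q → 2 + treeSize q ≤ B → treeSize (collT f q) ≤ treeSize q * B
  size-collT f leaf q≤ = positive leaf q≤
  size-collT f q@(node leaf p) q≤ = positive q q≤
  size-collT f q@(node (node _ leaf) p) q≤ = atomic q q≤
  size-collT f q@(node (node _ (node _ leaf)) leaf) q≤ = positive q q≤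
  size-collT f (node a@(node _ (node _ leaf)) p@(node q₁ q₂)) q≤ = begin
    treeSize (appT (collT f q₁) (collT f q₂))         ≤⟨ size-appT (collT f q₁) _ ⟩
    treeSize (collT f q₁) + treeSize (collT f q₂)     ≤⟨ +-mono-≤ (size-collT f q₁ (≤-trans (s≤s (s≤s (≤-trans (left≤ q₁ q₂) (right≤ a p)))) q≤))
                                                                  (size-collT f q₂ (≤-trans (s≤s (s≤s (≤-trans (right≤ q₁ q₂) (right≤ a p)))) q≤)) ⟩
    treeSize q₁ * B + treeSize q₂ * B                 ≡⟨ *-distribʳ-+ B (treeSize q₁) _ ⟨
    (treeSize q₁ + treeSize q₂) * B                   ≤⟨ *-monoˡ-≤ B (≤-trans (n≤1+n _) (right≤ a p)) ⟩
    treeSize (node a p) * B                           ∎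
    where open ≤-Reasoning
  size-collT f q@(node (node _ (node _ (node _ _))) leaf) q≤ = atomic q q≤
  size-collT leaf q@(node (node _ (node _ (node _ _))) (node S r)) q≤ = atomic q q≤
  size-collT f@(node _ _) q@(node a@(node _ (node _ (node _ _))) p@(node S r)) q≤ = begin
    suc (treeSize q + treeSize (collT f r))  ≤⟨ +-mono-≤ (≤-trans (n≤1+n _) q≤)
                                                         (size-collT f r (≤-trans (s≤s (s≤s (≤-trans (right≤ S r) (right≤ a p)))) q≤)) ⟩
    (1 + treeSize r) * B                     ≤⟨ *-monoˡ-≤ B (s≤s (≤-trans (right≤ S r) (m≤n+m _ (treeSize a)))) ⟩
    treeSize q * B                           ∎
    where open ≤-Reasoning

instance
  ok-var : ∀ {s n} {i : Fin n} → Ok s (var i)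
  ok-var = var

  ok-leaf : ∀ {s n} → Ok s (leaf {n = n})
  ok-leaf = leaf

  ok-node : ∀ {s n} {a b : Exp K n} → ⦃ Ok s a ⦄ → ⦃ Ok s b ⦄ → Ok s (node a b)
  ok-node = node

  ok-case : ∀ {s n} {e a : Exp K n} {b} → ⦃ Ok s e ⦄ → ⦃ Ok s a ⦄ → ⦃ Ok s b ⦄ → Ok s (case e a b)
  ok-case = case

  ok-bind : ∀ {s n} {a : Exp K n} {b} → ⦃ Ok s a ⦄ → ⦃ Ok s b ⦄ → Ok s (bind a b)
  ok-bind = bind

  ok-call : ∀ {s n f} {e : Exp K n} → ⦃ Good f ⦄ → ⦃ Ok s e ⦄ → Ok s (call f e)
  ok-call = call

app-good : Good app
app-good = good-rec app refl ok correct 1 out≤ recs≤ decreasing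
  where
  ok : Ok (just app) appE
  ok = case ⦃ it ⦄ ⦃ it ⦄ ⦃ case ⦃ it ⦄ ⦃ it ⦄ ⦃ node ⦃ it ⦄ ⦃ self refl it ⦄ ⦄ ⦄
  correct : ∀ t → val appE (t ∷ []) ≡ sem app t
  correct leaf = refl
  correct (node m leaf) = refl
  correct (node m (node x l)) = refl
  out≤ : ∀ t → treeSize (sem app t) ≤ pw 1 (treeSize t)
  out≤ leaf = ≤pw₁ 1
  out≤ (node m l) = ≤-trans (≤-trans (size-appT l m) (≤-trans (≤-reflexive (+-comm (treeSize l) _)) (n≤1+n _))) (≤pw₁ _)
  recs≤ : ∀ t → All (λ s → treeSize s ≤ treeSize t) (recs ok (t ∷ []))
  recs≤ leaf = []
  recs≤ (node m leaf) = []
  recs≤ (node m (node x l)) = s≤s (+-monoʳ-≤ (treeSize m) (right≤ x l)) ∷ []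
  decreasing : ∀ t → sum (map rank (recs ok (t ∷ []))) < rank t
  decreasing leaf = s≤s z≤n
  decreasing (node m leaf) = s≤s z≤n
  decreasing (node m (node x l)) = s≤s (≤-trans (≤-reflexive (+-identityʳ _)) (m≤n+m _ (treeSize x)))

opaque
  instance
    good-app : Good app
    good-app = app-good

eq-good : Good eq
eq-good = good-rec eq refl ok correct 2 out≤ recs≤ decreasing
  where
  ok : Ok (just eq) eqE
  ok = case ⦃ it ⦄ ⦃ it ⦄ ⦃ case ⦃ it ⦄ ⦃ it ⦄
         ⦃ case ⦃ it ⦄ ⦃ it ⦄ ⦃ case ⦃ self refl it ⦄ ⦃ it ⦄ ⦃ self refl it ⦄ ⦄ ⦄ ⦄
  correct : ∀ t → val eqE (t ∷ []) ≡ sem eq t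
  correct leaf = refl
  correct (node leaf leaf) = refl
  correct (node leaf (node _ _)) = refl
  correct (node (node _ _) leaf) = refl
  correct (node (node a b) (node c d)) with eqT a c
  ... | leaf     = refl
  ... | node _ _ = refl
  out≤ : ∀ t → treeSize (sem eq t) ≤ pw 2 (treeSize t)
  out≤ leaf = 1≤pw 2 1
  out≤ t@(node x y) = ≤-trans (size-eqT x y)
    (pw-+ {1} {0} _ (pw-+ {0} {0} _ (1≤pw 0 _) (1≤pw 0 _)) (1≤pw 0 _))
  recs≤ : ∀ t → All (λ s → treeSize s ≤ treeSize t) (recs ok (t ∷ []))
  recs≤ leaf = []
  recs≤ (node leaf leaf) = []
  recs≤ (node leaf (node _ _)) = []
  recs≤ (node (node _ _) leaf) = []
  recs≤ (node (node a b) (node c d)) with eqT a c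
  ... | leaf     = s≤s (+-mono-≤ (left≤ a b) (left≤ c d)) ∷ []
  ... | node _ _ = s≤s (+-mono-≤ (left≤ a b) (left≤ c d)) ∷ s≤s (+-mono-≤ (right≤ a b) (right≤ c d)) ∷ []
  decreasing : ∀ t → sum (map rank (recs ok (t ∷ []))) < rank t
  decreasing leaf = s≤s z≤n
  decreasing (node leaf leaf) = s≤s z≤n
  decreasing (node leaf (node _ _)) = s≤s z≤n
  decreasing (node (node _ _) leaf) = s≤s z≤n
  decreasing (node (node a b) (node c d)) with eqT a c
  ... | leaf     = s≤s (≤-trans (≤-reflexive (+-identityʳ _)) (m≤m+n _ (treeSize d)))
  ... | node _ _ = s≤s (≤-reflexive (cong (treeSize c +_) (+-identityʳ _)))

opaque
  instance
    good-eq : Good eq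
    good-eq = eq-good

coll-good : Good coll
coll-good = good-rec coll refl ok correct 2 out≤ recs≤ decreasing
  where
  ok : Ok (just coll) collE
  ok = case ⦃ it ⦄ ⦃ it ⦄ ⦃ case ⦃ it ⦄ ⦃ it ⦄ ⦃ case ⦃ it ⦄ ⦃ it ⦄ ⦃ case ⦃ it ⦄ ⦃ it ⦄ ⦃ case ⦃ it ⦄
         ⦃ case ⦃ it ⦄ ⦃ it ⦄ ⦃ call ⦃ it ⦄ ⦃ node ⦃ self refl it ⦄ ⦃ self refl it ⦄ ⦄ ⦄ ⦄
         ⦃ node ⦃ it ⦄ ⦃ case ⦃ it ⦄ ⦃ it ⦄ ⦃ case ⦃ it ⦄ ⦃ it ⦄ ⦃ self refl it ⦄ ⦄ ⦄ ⦄ ⦄ ⦄ ⦄ ⦄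
  correct : ∀ t → val collE (t ∷ []) ≡ sem coll t
  correct leaf = refl
  correct (node f leaf) = refl
  correct (node f (node leaf p)) = refl
  correct (node f (node (node _ leaf) p)) = refl
  correct (node f (node (node _ (node _ leaf)) leaf)) = refl
  correct (node f (node (node _ (node _ leaf)) (node q₁ q₂))) = refl
  correct (node f (node (node _ (node _ (node _ _))) leaf)) = refl
  correct (node leaf (node (node _ (node _ (node _ _))) (node S r))) = refl
  correct (node (node _ _) (node (node _ (node _ (node _ _))) (node S r))) = refl
  out≤ : ∀ t → treeSize (sem coll t) ≤ pw 2 (treeSize t)
  out≤ leaf = 1≤pw 2 1
  out≤ t@(node f q) = ≤-trans (size-collT f q (2+≤pw₁ (treeSize q)))
    (≤-trans (pw-* {1} {1} (treeSize q) (≤pw₁ _) ≤-refl) (pw-mono 2 (right≤ f q)))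
  recs≤ : ∀ t → All (λ s → treeSize s ≤ treeSize t) (recs ok (t ∷ []))
  recs≤ leaf = []
  recs≤ (node f leaf) = []
  recs≤ (node f (node leaf p)) = []
  recs≤ (node f (node (node _ leaf) p)) = []
  recs≤ (node f (node (node _ (node _ leaf)) leaf)) = []
  recs≤ (node f (node a@(node _ (node _ leaf)) p@(node q₁ q₂))) =
      s≤s (+-monoʳ-≤ (treeSize f) (≤-trans (right≤ q₁ q₂) (right≤ a p)))
    ∷ s≤s (+-monoʳ-≤ (treeSize f) (≤-trans (left≤ q₁ q₂) (right≤ a p))) ∷ []
  recs≤ (node f (node (node _ (node _ (node _ _))) leaf)) = []
  recs≤ (node leaf (node (node _ (node _ (node _ _))) (node S r))) = []
  recs≤ (node f@(node _ _) (node a@(node _ (node _ (node _ _))) p@(node S r))) =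
    s≤s (+-monoʳ-≤ (treeSize f) (≤-trans (right≤ S r) (right≤ a p))) ∷ []
  decreasing : ∀ t → sum (map rank (recs ok (t ∷ []))) < rank t
  decreasing leaf = s≤s z≤n
  decreasing (node f leaf) = s≤s z≤n
  decreasing (node f (node leaf p)) = s≤s z≤n
  decreasing (node f (node (node _ leaf) p)) = s≤s z≤n
  decreasing (node f (node (node _ (node _ leaf)) leaf)) = s≤s z≤n
  decreasing (node f (node a@(node _ (node _ leaf)) p@(node q₁ q₂))) =
    s≤s (≤-trans (≤-reflexive (trans (cong (treeSize q₂ +_) (+-identityʳ _)) (+-comm (treeSize q₂) _)))
                 (≤-trans (n≤1+n _) (m≤n+m _ (treeSize a))))
  decreasing (node f (node (node _ (node _ (node _ _))) leaf)) = s≤s z≤n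
  decreasing (node leaf (node (node _ (node _ (node _ _))) (node S r))) = s≤s z≤n
  decreasing (node f@(node _ _) (node a@(node _ (node _ (node _ _))) p@(node S r))) =
    s≤s (≤-trans (≤-reflexive (+-identityʳ _)) (≤-trans (right≤ S r) (m≤n+m _ (treeSize a))))

opaque
  instance
    good-coll : Good coll
    good-coll = coll-good

opaque
  instance
    good-len : Good len
    good-len = good-gather len {lenE} refl (λ _ → refl) (λ _ _ _ → refl)

    good-colls : Good colls
    good-colls = good-gather colls {collsE} refl (λ _ → refl) (λ _ _ _ → refl)

    good-pool : Good pool
    good-pool = good-gather pool {poolE} refl (λ _ → refl) (λ _ _ _ → refl)

    good-singles : Good singles
    good-singles = good-gather singles {singlesE} refl (λ _ → refl) (λ _ _ _ → refl)

    good-prep : Good prep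
    good-prep = good-gather prep {prepE} refl (λ _ → refl) (λ _ _ _ → refl)

    good-ext : Good ext
    good-ext = good-gather ext {extE} refl (λ _ → refl) (λ _ _ _ → refl)

    good-mem : Good mem
    good-mem = good-gather mem {memE} refl (λ _ → refl) (λ _ _ _ → refl)

    good-refutes : Good refutes
    good-refutes = good-gather refutes {refutesE} refl (λ _ → refl) (λ _ _ _ → refl)

    good-viol : Good viol
    good-viol = good-gather viol {violE} refl (λ _ → refl) (λ _ _ _ → refl)

    good-concepts₁ : Good concepts₁
    good-concepts₁ = good-gather concepts₁ {concepts₁E} refl (λ _ → refl) (λ _ _ _ → refl)

    good-concepts : Good concepts
    good-concepts = good-gather concepts {conceptsE} refl (λ _ → refl) (λ _ _ _ → refl)

    good-roles₁ : Good roles₁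
    good-roles₁ = good-gather roles₁ {roles₁E} refl (λ _ → refl) (λ _ _ _ → refl)

    good-roles₂ : Good roles₂
    good-roles₂ = good-gather roles₂ {roles₂E} refl (λ _ → refl) (λ _ _ _ → refl)

    good-roles : Good roles
    good-roles = good-gather roles {rolesE} refl (λ _ → refl) (λ _ _ _ → refl)

    good-missing : Good missing
    good-missing = good-gather missing {missingE} refl (λ _ → refl) (λ _ _ _ → refl)

    good-points : Good points
    good-points = good-gather points {pointsE} refl (λ _ → refl) (λ _ _ _ → refl)

-- The enumeration of selections, measured by its own output

choices-ok : Ok (just choices) choicesE
choices-ok = case ⦃ it ⦄ ⦃ it ⦄ ⦃ case ⦃ it ⦄ ⦃ it ⦄ ⦃ bind ⦃ self refl it ⦄ ⦃ it ⦄ ⦄ ⦄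

spine : Tree → ℕ
spine leaf       = 0
spine (node _ t) = suc (spine t)

spine≤size : ∀ t → suc (spine t) ≤ treeSize t
spine≤size leaf       = ≤-refl
spine≤size (node s t) = s≤s (≤-trans (spine≤size t) (m≤n+m _ _))

size-prepT : ∀ q R → treeSize (prepT q R) ≤ treeSize R * (2 + treeSize q)
size-prepT q leaf = s≤s z≤n
size-prepT q (node t R) = begin
  suc (suc (treeSize q + treeSize t) + treeSize (prepT q R))
    ≤⟨ +-mono-≤ (+-monoʳ-≤ (2 + treeSize q) (m≤m*n (treeSize t) (2 + treeSize q))) (size-prepT q R) ⟩
  (1 + treeSize t) * (2 + treeSize q) + treeSize R * (2 + treeSize q)
    ≡⟨ *-distribʳ-+ (2 + treeSize q) (1 + treeSize t) (treeSize R) ⟨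
  treeSize (node t R) * (2 + treeSize q) ∎
  where open ≤-Reasoning

-- One more pool multiplies the size by at most `1 + M * (2 + M)`, hence the 3 for each pool. The
-- number of pools affects the exponent only.
size-choicesT : ∀ Ls M → treeSize Ls ≤ M → treeSize (choicesT Ls) ≤ pw (3 * suc (spine Ls)) M
size-choicesT leaf M Ls≤ =
  ≤-trans (pw-+ {0} {1} M (1≤pw 0 M) (≤-trans (m≤m+n 2 M) (2+≤pw₁ M))) (pw-monoʳ M (n≤1+n 2))
size-choicesT (node L Ls) M Ls≤ = begin
  treeSize (appT R (extT R L))                   ≤⟨ size-appT R (extT R L) ⟩
  treeSize R + treeSize (extT R L)               ≤⟨ +-mono-≤ (m≤n*m (treeSize R) 1) ext≤ ⟩
  1 * treeSize R + M * (2 + M) * treeSize R      ≡⟨ *-distribʳ-+ (treeSize R) 1 (M * (2 + M)) ⟨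
  (1 + M * (2 + M)) * treeSize R                 ≤⟨ pw-* {3} {3 * suc (spine Ls)} M
                                                      (pw-+ {0} {2} M (1≤pw 0 M) (pw-* {1} {1} M (≤pw₁ M) (2+≤pw₁ M)))
                                                      (size-choicesT Ls M (≤-trans (right≤ L Ls) Ls≤)) ⟩
  pw (3 + 3 * suc (spine Ls)) M                  ≡⟨ cong (λ d → pw d M) (sym (*-suc 3 (suc (spine Ls)))) ⟩
  pw (3 * suc (spine (node L Ls))) M             ∎
  where
  open ≤-Reasoning
  R : Tree
  R = choicesT Ls
  L≤ : treeSize L ≤ M
  L≤ = ≤-trans (left≤ L Ls) Ls≤
  ext≤ : treeSize (extT R L) ≤ M * (2 + M) * treeSize R
  ext≤ = begin
    treeSize (extT R L)              ≤⟨ size-gatherT _ R {(2 + M) * treeSize R} M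
                                          (λ x xs x≤ → ≤-trans (size-prepT x R)
                                            (≤-trans (*-monoʳ-≤ (treeSize R) (+-monoʳ-≤ 2 (≤-trans (left≤ x xs) x≤)))
                                                     (≤-reflexive (*-comm (treeSize R) _))))
                                          (*-mono-≤ {1} {2 + M} (s≤s z≤n) (treeSize>0 R)) L L≤ ⟩
    treeSize L * ((2 + M) * treeSize R) ≤⟨ *-monoˡ-≤ _ L≤ ⟩
    M * ((2 + M) * treeSize R)       ≡⟨ *-assoc M (2 + M) _ ⟨
    M * (2 + M) * treeSize R         ∎

size≤appT : ∀ l m → treeSize l ≤ treeSize (appT l m)
size≤appT leaf m = treeSize>0 m
size≤appT (node x l) m = s≤s (+-monoʳ-≤ (treeSize x) (size≤appT l m))

choicesT-tail≤ : ∀ Ls L {N} → treeSize (choicesT (node L Ls)) ≤ N → treeSize (choicesT Ls) ≤ N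
choicesT-tail≤ Ls L = ≤-trans (size≤appT (choicesT Ls) _)

-- The output has no polynomial bound, so `N` is asked to bound the output itself. It then bounds
-- those of the recursive calls, which are initial parts of it.
ChoicesBound : ℕ → Tree → Set
ChoicesBound N t = treeSize t ≤ N × treeSize (sem choices t) ≤ N

choices-correct : ∀ t → val choicesE (t ∷ []) ≡ sem choices t
choices-correct leaf                = refl
choices-correct (node _ leaf)       = refl
choices-correct (node _ (node _ _)) = refl

choices-recs : ∀ {N} t → ChoicesBound N t →
               All (λ s → ChoicesBound N s × treeSize (sem choices s) ≤ N) (recs choices-ok (t ∷ []))
choices-recs leaf                 _            = []
choices-recs (node _ leaf)        _            = []
choices-recs (node d (node L Ls)) (t≤ , out≤) =
  ((≤-trans (s≤s (+-monoʳ-≤ (treeSize d) (right≤ L Ls))) t≤ , choicesT-tail≤ Ls L out≤)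
   , choicesT-tail≤ Ls L out≤) ∷ []

choices-decreasing : ∀ t → sum (map rank (recs choices-ok (t ∷ []))) < rank t
choices-decreasing leaf                 = s≤s z≤n
choices-decreasing (node _ leaf)        = s≤s z≤n
choices-decreasing (node _ (node L Ls)) = s≤s (≤-trans (≤-reflexive (+-identityʳ _)) (m≤n+m _ (treeSize L)))

module Choices = Recursion choices refl choices-ok choices-correct ChoicesBound (λ _ → proj₁) choices-recs choices-decreasing

-- The whole program and its cost

separatePoolsE commonPoolE : Exp K 1
separatePoolsE = case (v 0) leaf (call₂ colls true′ (v 1))
commonPoolE = case (v 0) leaf (call₂ singles leaf (call₂ pool true′ (v 1)))

memberE : Exp K 2
memberE = case (v 1) leaf (case (v 0) leaf
  -- Variables 0, 1, 3 and 4 are the numbers of unary and of binary symbols, `Q`, and the list of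
  -- points.
  (call₂ points (node (v 3) (call₂ app (call₂ roles (node (v 1) (v 4)) (v 4)) (call₂ concepts (v 0) (v 4)))) (v 4)))

program : Exp K 1 → Program
program pools = record { funs = K ; body = body ; main = bind (call₂ choices leaf pools) memberE }

program-cost : ∀ {W τ a a′ c₁ c₂ c₃ r} A B C D → a ≤ pw A W → τ ≤ W → c₁ ≤ pw B W → c₂ ≤ pw C W →
  r ≤ a → a′ ≤ a → c₃ ≤ r * pw D (a′ + τ) →
  c₁ + c₃ + 1 + c₂ + 1 ≤ pw (1 + ((1 + ((1 + ((1 + (B + (A + (2 + (1 + (A + 1))) * D))) + 0)) + C)) + 0)) W
program-cost {W} A B C D a≤ τ≤ c₁≤ c₂≤ r≤ a′≤ c₃≤ =
  pw-+ W (pw-+ W (pw-+ W (pw-+ W c₁≤ (≤-trans c₃≤ (pw-* W (≤-trans r≤ a≤)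
    (pw-∘ W ≤-refl (pw-+ {A} {1} W (≤-trans a′≤ a≤) (≤-trans τ≤ (≤pw₁ W))))))) (1≤pw 0 W)) c₂≤) (1≤pw 0 W)

opaque
  -- The only superpolynomial part of the cost is the size τ of choicesT.
  program-runs : ∀ {pools} → Ok nothing pools →
    ∃[ d ] ∃[ e ] (∀ input → let T = choicesT (val pools (input ∷ [])) in
      (treeSize (val pools (input ∷ [])) ≤ pw d (treeSize input)) ×
      (∀ τ → treeSize T ≤ τ →
        program pools maps input to val memberE (T ∷ input ∷ []) within pw e (treeSize input + τ)))
  program-runs {pools} ok = _ , _ , λ input → pools≤ input , run input
    where
    arg : Ok nothing (node leaf pools)
    arg = node ⦃ leaf ⦄ ⦃ ok ⦄
    rest : Ok nothing memberE
    rest = it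
    pools≤ : ∀ input → treeSize (val pools (input ∷ [])) ≤ pw (vdeg ok) (treeSize input)
    pools≤ input = val-size ok _ (≤-refl V.∷ V.[]) (λ ())
    module _ (input : Tree) (τ : ℕ) (T≤ : treeSize (choicesT (val pools (input ∷ []))) ≤ τ) where
      W : ℕ
      W = treeSize input + τ
      a : Tree
      a = node leaf (val pools (input ∷ []))
      r₁ : Evals (node leaf pools) (input ∷ []) (pw (cdeg arg) (treeSize input))
      r₁ = eval-closed arg (treeSize input) (≤-refl V.∷ V.[])
      r₂ : Evals memberE (choicesT (val pools (input ∷ [])) ∷ input ∷ []) (pw (cdeg rest) W)
      r₂ = eval-closed rest W (≤-trans T≤ (m≤n+m τ _) V.∷ m≤m+n _ τ V.∷ V.[])
      r₃ : Runs choices a (rank a * pw (cdeg choices-ok) (treeSize a + τ))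
      r₃ = Choices.run (treeSize a + τ) (rank a) a ≤-refl (m≤m+n _ τ , ≤-trans T≤ (m≤n+m τ _))
      run : program pools maps input to val memberE (choicesT (val pools (input ∷ [])) ∷ input ∷ []) within _
      run = _ , ⇓bind (⇓call (proj₁ (proj₂ r₁)) (proj₁ (proj₂ r₃))) (proj₁ (proj₂ r₂)) ,
        program-cost (vdeg arg) (cdeg arg) (cdeg rest) (cdeg choices-ok)
          (≤-trans (val-size arg (treeSize input) (≤-refl V.∷ V.[]) (λ ())) (pw-mono (vdeg arg) (m≤m+n _ τ)))
          (m≤n+m τ _) (≤-trans (proj₂ (proj₂ r₁)) (pw-mono (cdeg arg) (m≤m+n _ τ))) (proj₂ (proj₂ r₂))
          (rank≤size a) ≤-refl (proj₂ (proj₂ r₃))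

-- Correctness of the program

isNode : Tree → Bool
isNode leaf       = false
isNode (node _ _) = Bool.true

caseT-isNode : ∀ {A : Set} t {a b : A} → caseT t a (λ _ _ → b) ≡ (if isNode t then b else a)
caseT-isNode leaf       = refl
caseT-isNode (node _ _) = refl

caseT-leaf : ∀ t → isNode (caseT t leaf (λ _ _ → leaf)) ≡ false
caseT-leaf leaf       = refl
caseT-leaf (node _ _) = refl

isNode-not : ∀ t → isNode (caseT t true (λ _ _ → leaf)) ≡ not (isNode t)
isNode-not leaf       = refl
isNode-not (node _ _) = refl

isNode-appT : ∀ l m → isNode (appT l m) ≡ isNode l ∨ isNode m
isNode-appT leaf       m = refl
isNode-appT (node x l) m = refl

eqT-reflects : ∀ s t → Reflects (s ≡ t) (isNode (eqT s t))
eqT-reflects leaf       leaf       = ofʸ refl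
eqT-reflects leaf       (node _ _) = ofⁿ λ ()
eqT-reflects (node _ _) leaf       = ofⁿ λ ()
eqT-reflects (node a b) (node c d) with eqT a c | eqT-reflects a c
... | leaf     | ofⁿ a≢c  = ofⁿ λ { refl → a≢c refl }
... | node _ _ | ofʸ refl with isNode (eqT b d) | eqT-reflects b d
...   | _ | ofʸ refl = ofʸ refl
...   | _ | ofⁿ b≢d  = ofⁿ λ { refl → b≢d refl }

_≟ᵀ_ : DecidableEquality Tree
s ≟ᵀ t = isNode (eqT s t) because eqT-reflects s t

node-injective : ∀ {a b c d} → Tree.node a b ≡ node c d → a ≡ c × b ≡ d
node-injective refl = refl , refl

encodeℕ-injective : ∀ {m n} → encodeℕ m ≡ encodeℕ n → m ≡ n
encodeℕ-injective {zero}  {zero}  eq = refl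
encodeℕ-injective {suc m} {suc n} eq = cong suc (encodeℕ-injective (proj₂ (node-injective eq)))

encodeFin-injective : ∀ {n} {i j : Fin n} → encodeFin i ≡ encodeFin j → i ≡ j
encodeFin-injective eq = Fin.toℕ-injective (encodeℕ-injective eq)

encodeRole-injective : {S S′ : Role Σ L} → encodeRole S ≡ encodeRole S′ → S ≡ S′
encodeRole-injective {S = fwd P} {fwd P′} eq = cong fwd (encodeFin-injective (proj₂ (node-injective eq)))
encodeRole-injective {S = inv P} {inv P′} eq = cong inv (encodeFin-injective (proj₂ (node-injective eq)))

encodeQuery-injective : {q q′ : Query Σ L} → encodeQuery q ≡ encodeQuery q′ → q ≡ q′
encodeQuery-injective {q = top} {top} eq = refl
encodeQuery-injective {q = atom A} {atom B} eq = cong atom (encodeFin-injective (proj₂ (node-injective eq)))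
encodeQuery-injective {q = q₁ ∧ q₂} {r₁ ∧ r₂} eq with node-injective (proj₂ (node-injective eq))
... | eq₁ , eq₂ = cong₂ _∧_ (encodeQuery-injective eq₁) (encodeQuery-injective eq₂)
encodeQuery-injective {q = some S q} {some S′ q′} eq with node-injective (proj₂ (node-injective eq))
... | eq₁ , eq₂ = cong₂ some (encodeRole-injective eq₁) (encodeQuery-injective eq₂)

-- Deciding equality on encodings makes `does` the answer of `eqT` by definition, so that the
-- program and its specification agree on membership at once.
_≟ᵠ_ : DecidableEquality (Query Σ L)
q ≟ᵠ q′ = map′ encodeQuery-injective (cong encodeQuery) (encodeQuery q ≟ᵀ encodeQuery q′)

-- The index of an element is the number of elements after it.
gather : (X → ℕ → List Y) → List X → List Y
gather h []       = []
gather h (x ∷ xs) = h x (length xs) ++ gather h xs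

-- Runs from the largest index down, the order in which the smaller numbers occur as tails of a
-- unary number.
gatherFin : ∀ {n} → (Fin n → List Y) → List Y
gatherFin {n = zero}  h = []
gatherFin {n = suc n} h = h (fromℕ n) ++ gatherFin (h ∘ inject₁)

collect : Bool → Query Σ L → List (Query Σ L)
collect b top        = []
collect b (atom A)   = atom A ∷ []
collect b (q₁ ∧ q₂)  = collect b q₁ ++ collect b q₂
collect b (some S q) = some S q ∷ (if b then collect b q else [])

conjuncts subqueries : Query Σ L → List (Query Σ L)
conjuncts  = collect false
subqueries = collect Bool.true

-- A point of the canonical instance is a list of queries that are to be
-- false there.
Point : Signature → Language → Set
Point Σ L = List (Query Σ L)

Refutes : Point Σ L → Query Σ L → Set
Refutes t q = Any (_∈ t) (conjuncts q)

-- The reason why an `S₀`-edge to `u` must be absent. Roles are compared by encodings because `S₀`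
-- may be inverse even if the queries are in `EL`; thus one canonical instance serves both
-- languages.
Violates : Role Σ ELI → Point Σ L → Query Σ L → Set
Violates S₀ u (some S r) = encodeRole S ≡ encodeRole S₀ × ¬ Refutes u r
Violates S₀ u _          = ⊥

member? : (q : Query Σ L) (t : Point Σ L) → Dec (q ∈ t)
member? q = any? (q ≟ᵠ_)

refutes? : (t : Point Σ L) → Decidable (Refutes t)
refutes? t q = any? (λ r → member? r t) (conjuncts q)

violates? : (S₀ : Role Σ ELI) (u : Point Σ L) → Decidable (Violates S₀ u)
violates? S₀ u top        = no λ ()
violates? S₀ u (atom A)   = no λ ()
violates? S₀ u (q₁ ∧ q₂)  = no λ ()
violates? S₀ u (some S r) = (encodeRole S ≟ᵀ encodeRole S₀) ×-dec ¬? (refutes? u r)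

selections : List (List X) → List (List X)
selections []       = [] ∷ []
selections (L ∷ Ls) = selections Ls ++ gather (λ x _ → gather (λ t _ → (x ∷ t) ∷ []) (selections Ls)) L

conceptsAt : Point Σ L → ℕ → List (Fact Σ)
conceptsAt t i = gatherFin λ A → if does (member? (atom A) t) then [] else concept A i ∷ []

rolesAt : Point Σ L → ℕ → Point Σ L → ℕ → List (Fact Σ)
rolesAt t i u j = gatherFin λ P →
  if does (any? (violates? (fwd P) u) t) then []
  else if does (any? (violates? (inv P) t) u) then []
  else role P i j ∷ []

canonical : List (Point Σ L) → Instance Σ
canonical T = gather conceptsAt T ++ gather (λ t i → gather (rolesAt t i) T) T

members : List (Query Σ L) → List (Point Σ L) → List (PointedInstance Σ)
members Q T = gather (λ t i → if does (any? (¬? ∘ refutes? t) Q) then [] else (canonical T , i) ∷ []) T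

separatePools commonPool : List (Query Σ L) → List (List (Query Σ L))
separatePools = gather λ q _ → subqueries q ∷ []
commonPool Q = gather (λ q _ → (q ∷ []) ∷ []) (gather (λ q _ → subqueries q) Q)

appT-++ : ∀ {enc : X → Tree} l m → appT (encodeList enc l) (encodeList enc m) ≡ encodeList enc (l ++ m)
appT-++ []      m = refl
appT-++ (x ∷ l) m = cong (node _) (appT-++ l m)

lenT-length : ∀ {enc : X → Tree} l → lenT (encodeList enc l) ≡ encodeℕ (length l)
lenT-length []      = refl
lenT-length (x ∷ l) = cong (node leaf) (lenT-length l)

encodeList-if : ∀ {enc : X → Tree} b {xs ys} →
                (if b then encodeList enc xs else encodeList enc ys) ≡ encodeList enc (if b then xs else ys)
encodeList-if Bool.true  = refl
encodeList-if false = refl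

gatherT-any : ∀ {g ctx} {enc : X → Tree} {P : X → Set} (P? : Decidable P) →
              (∀ x xs → isNode (g ctx (enc x) xs) ≡ does (P? x)) →
              ∀ l → isNode (gatherT g ctx (encodeList enc l)) ≡ does (any? P? l)
gatherT-any P? h []      = refl
gatherT-any {g = g} {ctx} {enc} P? h (x ∷ l) =
  trans (isNode-appT (g ctx (enc x) (encodeList enc l)) _) (cong₂ _∨_ (h x _) (gatherT-any P? h l))

gatherT-gather : ∀ {g ctx} {enc : X → Tree} {enc′ : Y → Tree} {h : X → ℕ → List Y} →
                 (∀ x xs → g ctx (enc x) (encodeList enc xs) ≡ encodeList enc′ (h x (length xs))) →
                 ∀ l → gatherT g ctx (encodeList enc l) ≡ encodeList enc′ (gather h l)
gatherT-gather eq [] = refl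
gatherT-gather {h = h} eq (x ∷ l) =
  trans (cong₂ appT (eq x l) (gatherT-gather {h = h} eq l)) (appT-++ (h x (length l)) _)

gatherT-gatherFin : ∀ {g ctx n} {enc : Y → Tree} {h : Fin n → List Y} →
                    (∀ i → g ctx leaf (encodeFin i) ≡ encodeList enc (h i)) →
                    gatherT g ctx (encodeℕ n) ≡ encodeList enc (gatherFin h)
gatherT-gatherFin {n = zero} eq = refl
gatherT-gatherFin {g = g} {ctx} {suc n} {h = h} eq = trans
  (cong₂ appT (trans (cong (λ i → g ctx leaf (encodeℕ i)) (sym (Fin.toℕ-fromℕ n))) (eq (fromℕ n)))
              (gatherT-gatherFin {h = h ∘ inject₁} λ i →
                trans (cong (λ j → g ctx leaf (encodeℕ j)) (sym (Fin.toℕ-inject₁ i))) (eq (inject₁ i))))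
  (appT-++ (h (fromℕ n)) _)

flagT : Bool → Tree
flagT false     = leaf
flagT Bool.true = true

collT-collect : ∀ b (q : Query Σ L) → collT (flagT b) (encodeQuery q) ≡ encodeList encodeQuery (collect b q)
collT-collect b top = refl
collT-collect b (atom A) = refl
collT-collect b (q₁ ∧ q₂) = trans (cong₂ appT (collT-collect b q₁) (collT-collect b q₂)) (appT-++ (collect b q₁) _)
collT-collect false (some S q) = refl
collT-collect Bool.true (some S q) = cong (node _) (collT-collect Bool.true q)

encodePoint : Point Σ L → Tree
encodePoint = encodeList encodeQuery

encodePoints : List (Point Σ L) → Tree
encodePoints = encodeList encodePoint

memT-member : (q : Query Σ L) (t : Point Σ L) →
              isNode (memT (encodeQuery q) (encodePoint t)) ≡ does (member? q t)
memT-member q = gatherT-any (q ≟ᵠ_) (λ _ _ → refl)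

refutesT-refutes : (t : Point Σ L) (q : Query Σ L) →
                   isNode (refutesT (encodePoint t) (conj (encodeQuery q))) ≡ does (refutes? t q)
refutesT-refutes t q = trans
  (cong (λ c → isNode (refutesT (encodePoint t) c)) (collT-collect false q))
  (gatherT-any (λ r → member? r t) (λ r _ → memT-member r t) (conjuncts q))

violT-violates : (S₀ : Role Σ ELI) (u t : Point Σ L) →
                 isNode (violT (node (encodeRole S₀) (encodePoint u)) (encodePoint t))
                   ≡ does (any? (violates? S₀ u) t)
violT-violates S₀ u = gatherT-any (violates? S₀ u) λ
  { top        _ → refl
  ; (atom A)   _ → caseT-leaf (encodeFin A)
  ; (q₁ ∧ q₂)  _ → refl
  ; (some S r) _ → existential S r
  }
  where
  existential : ∀ S r → isNode (caseT (eqT (encodeRole S) (encodeRole S₀)) leaf λ _ _ →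
                                 caseT (refutesT (encodePoint u) (conj (encodeQuery r))) true λ _ _ → leaf)
                        ≡ does (violates? S₀ u (some S r))
  existential S r with eqT (encodeRole S) (encodeRole S₀)
  ... | leaf     = refl
  ... | node _ _ = trans (isNode-not (refutesT (encodePoint u) (conj (encodeQuery r))))
                         (cong not (refutesT-refutes u r))

conceptsT-concepts : (T : List (Point Σ L)) →
  conceptsT (encodeℕ (unary Σ)) (encodePoints T) ≡ encodeList encodeFact (gather conceptsAt T)
conceptsT-concepts {Σ} {L} T = gatherT-gather {h = conceptsAt} (λ t ts → trans
  (cong (λ i → concepts₁T (node (encodePoint t) i) (encodeℕ (unary Σ))) (lenT-length ts))
  (gatherT-gatherFin λ A → trans (caseT-isNode (memT (encodeQuery {Σ} {L} (atom A)) (encodePoint t)))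
    (trans (cong (λ b → if b then _ else _) (memT-member (atom A) t))
           (encodeList-if (does (member? (atom A) t)) {[]} {concept A (length ts) ∷ []})))) T

rolesT-roles : (T : List (Point Σ L)) →
  rolesT (node (encodeℕ (binary Σ)) (encodePoints T)) (encodePoints T)
    ≡ encodeList encodeFact (gather (λ t i → gather (rolesAt t i) T) T)
rolesT-roles {Σ} T = gatherT-gather {h = λ t i → gather (rolesAt t i) T} (λ t ts → trans
  (cong (λ i → roles₂T (node (node (encodePoint t) i) (encodeℕ (binary Σ))) (encodePoints T)) (lenT-length ts))
  (gatherT-gather {h = rolesAt t (length ts)} (λ u us → trans
    (cong (λ j → roles₁T (node (node (encodePoint t) (encodeℕ (length ts))) (node (encodePoint u) j)) (encodeℕ (binary Σ)))
          (lenT-length us))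
    (gatherT-gatherFin (edge t (length ts) u (length us)))) T)) T
  where
  edge : ∀ t i u j P → _ ≡ encodeList encodeFact
    (if does (any? (violates? (fwd P) u) t) then []
     else if does (any? (violates? (inv P) t) u) then [] else role P i j ∷ [])
  edge t i u j P = trans (caseT-isNode (violT (node (encodeRole {Σ} {ELI} (fwd P)) (encodePoint u)) (encodePoint t))) (trans
    (cong₂ (λ b x → if b then leaf else x) (violT-violates (fwd P) u t)
      (trans (caseT-isNode (violT (node (encodeRole {Σ} (inv P)) (encodePoint t)) (encodePoint u)))
        (trans (cong (λ b → if b then _ else _) (violT-violates (inv P) t u))
               (encodeList-if (does (any? (violates? (inv P) t) u)) {[]} {role P i j ∷ []}))))
    (encodeList-if (does (any? (violates? (fwd P) u) t)) {[]}))

memberE-members : (Q : List (Query Σ L)) (T : List (Point Σ L)) →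
  val memberE (encodePoints T ∷ encodeInput Σ Q ∷ []) ≡ encodeOutput (members Q T)
memberE-members {Σ} Q T = trans
  (cong (λ 𝒜 → pointsT (node (encodeList encodeQuery Q) 𝒜) (encodePoints T))
    (trans (cong₂ appT (conceptsT-concepts T) (rolesT-roles T)) (appT-++ (gather conceptsAt T) _)))
  (gatherT-gather {h = λ t i → if does (any? (¬? ∘ refutes? t) Q) then [] else (canonical T , i) ∷ []}
    (λ t ts → trans (caseT-isNode (missingT (encodePoint t) (encodeList encodeQuery Q))) (trans
      (cong₂ (λ b i → if b then leaf else node (node (encodeList encodeFact (canonical T)) i) leaf)
        (gatherT-any (¬? ∘ refutes? t) (λ q _ → trans
          (isNode-not (refutesT (encodePoint t) (conj (encodeQuery q)))) (cong not (refutesT-refutes t q))) Q) (lenT-length ts))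
      (encodeList-if (does (any? (¬? ∘ refutes? t) Q)) {[]}))) T)

choicesT-selections : (Ls : List (List (Query Σ L))) → choicesT (encodePoints Ls) ≡ encodePoints (selections Ls)
choicesT-selections [] = refl
choicesT-selections (L ∷ Ls) rewrite choicesT-selections Ls = trans
  (cong (appT (encodePoints (selections Ls)))
    (gatherT-gather {h = λ x _ → gather (λ t _ → (x ∷ t) ∷ []) (selections Ls)}
      (λ x _ → gatherT-gather {h = λ t _ → (x ∷ t) ∷ []} (λ _ _ → refl) (selections Ls)) L))
  (appT-++ (selections Ls) _)

separatePoolsE-correct : (Q : List (Query Σ L)) → val separatePoolsE (encodeInput Σ Q ∷ []) ≡ encodePoints (separatePools Q)
separatePoolsE-correct = gatherT-gather {h = λ q _ → subqueries q ∷ []} λ q _ → cong (λ t → node t leaf) (collT-collect Bool.true q)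

commonPoolE-correct : (Q : List (Query Σ L)) → val commonPoolE (encodeInput Σ Q ∷ []) ≡ encodePoints (commonPool Q)
commonPoolE-correct Q = trans
  (cong (singlesT leaf) (gatherT-gather {h = λ q _ → subqueries q} (λ q _ → collT-collect Bool.true q) Q))
  (gatherT-gather {h = λ q _ → (q ∷ []) ∷ []} (λ _ _ → refl) (gather (λ q _ → subqueries q) Q))

-- The canonical instance

data At {X : Set} : List X → X → ℕ → Set where
  here  : ∀ {x xs} → At (x ∷ xs) x (length xs)
  there : ∀ {x xs y i} → At xs y i → At (x ∷ xs) y i

At-< : ∀ {l : List X} → At l x i → i < length l
At-< here      = ≤-refl
At-< (there p) = m<n⇒m<1+n (At-< p)

At-unique : ∀ {l : List X} → At l x i → At l y i → x ≡ y
At-unique here      here      = refl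
At-unique here      (there q) = ⊥-elim (<-irrefl refl (At-< q))
At-unique (there p) here      = ⊥-elim (<-irrefl refl (At-< p))
At-unique (there p) (there q) = At-unique p q

∈⇒At : ∀ {l : List X} → x ∈ l → ∃[ i ] At l x i
∈⇒At (here refl) = _ , here
∈⇒At (there p)   = _ , there (proj₂ (∈⇒At p))

At⇒∈ : ∀ {l : List X} → At l x i → x ∈ l
At⇒∈ here      = here refl
At⇒∈ (there p) = there (At⇒∈ p)

∈-gather⁺ : ∀ (h : X → ℕ → List Y) {l} → At l x i → y ∈ h x i → y ∈ gather h l
∈-gather⁺ h here                  q = ∈-++⁺ˡ q
∈-gather⁺ h (there {x} {xs} p) q = ∈-++⁺ʳ (h x (length xs)) (∈-gather⁺ h p q)

∈-gather⁻ : ∀ (h : X → ℕ → List Y) l → y ∈ gather h l → ∃[ x ] ∃[ i ] (At l x i × y ∈ h x i)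
∈-gather⁻ h (x ∷ l) p with ∈-++⁻ (h x (length l)) p
... | inj₁ q = _ , _ , here , q
... | inj₂ q with ∈-gather⁻ h l q
...   | x′ , i , r , s = x′ , i , there r , s

∈-gatherFin⁺ : ∀ {n} (h : Fin n → List Y) k → y ∈ h k → y ∈ gatherFin h
∈-gatherFin⁺ {n = suc n} h k p with view k
... | ‵fromℕ     = ∈-++⁺ˡ p
... | ‵inject₁ k = ∈-++⁺ʳ (h (fromℕ n)) (∈-gatherFin⁺ (h ∘ inject₁) k p)

∈-gatherFin⁻ : ∀ {n} (h : Fin n → List Y) → y ∈ gatherFin h → ∃[ k ] (y ∈ h k)
∈-gatherFin⁻ {n = suc n} h p with ∈-++⁻ (h (fromℕ n)) p
... | inj₁ q = _ , q
... | inj₂ q = _ , proj₂ (∈-gatherFin⁻ (h ∘ inject₁) q)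

∈-unless⁺ : ∀ (d : Dec A) {l : List Y} → ¬ A → y ∈ l → y ∈ (if does d then [] else l)
∈-unless⁺ (yes a) ¬a p = ⊥-elim (¬a a)
∈-unless⁺ (no _)  ¬a p = p

∈-unless⁻ : ∀ (d : Dec A) {l : List Y} → y ∈ (if does d then [] else l) → ¬ A × y ∈ l
∈-unless⁻ (no ¬a) p = ¬a , p

Compatible : Fin (binary Σ) → Point Σ L → Point Σ L → Set
Compatible P t u = ¬ Any (Violates (fwd P) u) t × ¬ Any (Violates (inv P) t) u

module _ {T : List (Point Σ L)} where

  concept∈⁺ : ∀ {A t} → At T t i → ¬ (atom A ∈ t) → concept A i ∈ canonical T
  concept∈⁺ {A = A} {t} at p = ∈-++⁺ˡ (∈-gather⁺ conceptsAt at
    (∈-gatherFin⁺ _ A (∈-unless⁺ (member? (atom A) t) p (here refl))))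

  role∈⁺ : ∀ {P t u} → At T t i → At T u j → Compatible P t u → role P i j ∈ canonical T
  role∈⁺ {P = P} {t} {u} at at′ (p , q) = ∈-++⁺ʳ (gather conceptsAt T)
    (∈-gather⁺ (λ t i → gather (rolesAt t i) T) at (∈-gather⁺ (rolesAt t _) at′
      (∈-gatherFin⁺ _ P (∈-unless⁺ (any? (violates? (fwd P) u) t) p
        (∈-unless⁺ (any? (violates? (inv P) t) u) q (here refl))))))

  ∈-concepts⁻ : ∀ {f} → f ∈ gather conceptsAt T →
                ∃[ A ] ∃[ i ] ∃[ t ] (f ≡ concept A i × At T t i × ¬ (atom A ∈ t))
  ∈-concepts⁻ p with ∈-gather⁻ conceptsAt T p
  ... | t , i , at , q with ∈-gatherFin⁻ _ q
  ...   | A , r with ∈-unless⁻ (member? (atom A) t) r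
  ...     | ¬p , here refl = A , i , t , refl , at , ¬p

  ∈-roles⁻ : ∀ {f} → f ∈ gather (λ t i → gather (rolesAt t i) T) T →
             ∃[ P ] ∃[ i ] ∃[ j ] ∃[ t ] ∃[ u ] (f ≡ role P i j × At T t i × At T u j × Compatible P t u)
  ∈-roles⁻ p with ∈-gather⁻ (λ t i → gather (rolesAt t i) T) T p
  ... | t , i , at , q with ∈-gather⁻ (rolesAt t i) T q
  ...   | u , j , at′ , r with ∈-gatherFin⁻ _ r
  ...     | P , s with ∈-unless⁻ (any? (violates? (fwd P) u) t) s
  ...       | ¬v , s′ with ∈-unless⁻ (any? (violates? (inv P) t) u) s′
  ...         | ¬w , here refl = P , i , j , t , u , refl , at , at′ , ¬v , ¬w

  concept∈⁻ : ∀ {A} → concept A i ∈ canonical T → ∃[ t ] (At T t i × ¬ (atom A ∈ t))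
  concept∈⁻ p with ∈-++⁻ (gather conceptsAt T) p
  ... | inj₁ q with ∈-concepts⁻ q
  ...   | _ , _ , t , refl , at , ¬p = t , at , ¬p
  concept∈⁻ p | inj₂ q with ∈-roles⁻ q
  ...   | _ , _ , _ , _ , _ , () , _

  role∈⁻ : ∀ {P} → role P i j ∈ canonical T → ∃[ t ] ∃[ u ] (At T t i × At T u j × Compatible P t u)
  role∈⁻ p with ∈-++⁻ (gather conceptsAt T) p
  ... | inj₁ q with ∈-concepts⁻ q
  ...   | _ , _ , _ , () , _
  role∈⁻ p | inj₂ q with ∈-roles⁻ q
  ...   | _ , _ , _ , t , u , refl , at , at′ , c = t , u , at , at′ , c

  no-violation : ∀ {S₀ t u} {S : Role Σ L} {r} → ¬ Any (Violates S₀ u) t → encodeRole S ≡ encodeRole S₀ →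
                 some S r ∈ t → Refutes u r
  no-violation {u = u} {r = r} ¬v eq p =
    decidable-stable (refutes? u r) λ ¬r → ¬v (lose p (eq , ¬r))

  -- If `some S r` is in `t`, an edge leads only to points that refute `r`, where the induction
  -- hypothesis applies. For inverse roles the second half of `Compatible` says this from the other
  -- end of the edge.
  sound : ∀ r {t} → At T t i → (canonical T , i) ⊨ r → ¬ Refutes t r
  sound (atom A) at p (here A∈t) with concept∈⁻ p
  ... | t′ , at′ , A∉t rewrite At-unique at at′ = A∉t A∈t
  sound (q₁ ∧ q₂) at (p , q) ref with Any.++⁻ (conjuncts q₁) ref
  ... | inj₁ ref₁ = sound q₁ at p ref₁
  ... | inj₂ ref₂ = sound q₂ at q ref₂
  sound (some (fwd P) r) at (b , p , q) (here r∈t) with role∈⁻ p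
  ... | _ , u , at₁ , at₂ , ¬v , ¬w rewrite At-unique at at₁ =
    sound r at₂ q (no-violation ¬v refl r∈t)
  sound (some (inv P) r) at (b , p , q) (here r∈t) with role∈⁻ p
  ... | u , _ , at₂ , at₁ , ¬v , ¬w rewrite At-unique at at₁ =
    sound r at₂ q (no-violation ¬w refl r∈t)

roleFact? : (S : Role Σ L) (a : Individual) {P : Individual → Set} → (∀ b → Dec (P b)) →
            ∀ f → Dec (∃[ b ] (roleFact S a b ≡ f × P b))
roleFact? (fwd P) a P? (concept _ _) = no λ ()
roleFact? (inv P) a P? (concept _ _) = no λ ()
roleFact? (fwd P) a P? (role R c b) =
  map′ (λ { ((refl , refl) , p) → b , refl , p }) (λ { (_ , refl , p) → (refl , refl) , p })
       ((P Fin.≟ R ×-dec a ≟ c) ×-dec P? b)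
roleFact? (inv P) a P? (role R b c) =
  map′ (λ { ((refl , refl) , p) → b , refl , p }) (λ { (_ , refl , p) → (refl , refl) , p })
       ((P Fin.≟ R ×-dec a ≟ c) ×-dec P? b)

-- A witness for `some` occurs in a fact, so searching the facts suffices. This is what allows
-- double negations to be removed.
⊨? : (q : Query Σ L) (𝒜 : Instance Σ) (a : Individual) → Dec ((𝒜 , a) ⊨ q)
⊨? top        𝒜 a = yes tt
⊨? (atom A)   𝒜 a = any? (concept A a ≟ᶠ_) 𝒜
⊨? (q₁ ∧ q₂)  𝒜 a = ⊨? q₁ 𝒜 a ×-dec ⊨? q₂ 𝒜 a
⊨? {Σ} (some S q) 𝒜 a = map′ to (λ { (b , p , h) → lose p (b , refl , h) }) (any? (roleFact? S a (⊨? q 𝒜)) 𝒜)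
  where
  to : Any (λ f → ∃[ b ] (roleFact S a b ≡ f × (𝒜 , b) ⊨ q)) 𝒜 → (𝒜 , a) ⊨ some S q
  to p with find p
  ... | f , f∈𝒜 , b , refl , h = b , f∈𝒜 , h

conjuncts-⊨ : ∀ (q : Query Σ L) {𝒜a} → (∀ {r} → r ∈ conjuncts q → 𝒜a ⊨ r) → 𝒜a ⊨ q
conjuncts-⊨ top        h = tt
conjuncts-⊨ (atom A)   h = h (here refl)
conjuncts-⊨ (q₁ ∧ q₂)  h = conjuncts-⊨ q₁ (h ∘ ∈-++⁺ˡ) , conjuncts-⊨ q₂ (h ∘ ∈-++⁺ʳ (conjuncts q₁))
conjuncts-⊨ (some S q) h = h (here refl)

conjuncts⊆subqueries : ∀ (q : Query Σ L) {r} → r ∈ conjuncts q → r ∈ subqueries q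
conjuncts⊆subqueries (atom A) p = p
conjuncts⊆subqueries (q₁ ∧ q₂) p with ∈-++⁻ (conjuncts q₁) p
... | inj₁ p₁ = ∈-++⁺ˡ (conjuncts⊆subqueries q₁ p₁)
... | inj₂ p₂ = ∈-++⁺ʳ (subqueries q₁) (conjuncts⊆subqueries q₂ p₂)
conjuncts⊆subqueries (some S q) (here eq) = here eq

-- To refute `some S r` at a point, each successor has to refute a conjunct of `r`; closure provides
-- that conjunct in the same pool.
Closed : List (Query Σ L) → Set
Closed l = ∀ {S r y} → some S r ∈ l → y ∈ conjuncts r → y ∈ l

subqueries-closed : (q : Query Σ L) → Closed (subqueries q)
subqueries-closed (atom A) (here ())
subqueries-closed (q₁ ∧ q₂) p y∈ with ∈-++⁻ (subqueries q₁) p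
... | inj₁ p₁ = ∈-++⁺ˡ (subqueries-closed q₁ p₁ y∈)
... | inj₂ p₂ = ∈-++⁺ʳ (subqueries q₁) (subqueries-closed q₂ p₂ y∈)
subqueries-closed (some S q) (here refl) y∈ = there (conjuncts⊆subqueries q y∈)
subqueries-closed (some S q) (there p)   y∈ = there (subqueries-closed q p y∈)

-- Soundness holds for every `T`, so completeness is the only hypothesis. Its double negation does
-- no harm, since satisfaction of `q′` by some member is decidable.
split-partner : (Q : List (Query Σ L)) (T : List (Point Σ L)) →
  (∀ q′ → All (λ q → ¬ (q′ entails q)) Q →
    ¬ ¬ (∃[ t ] ∃[ i ] (At T t i × All (Refutes t) Q × (canonical T , i) ⊨ q′))) →
  IsSplitPartner Q (members Q T)
split-partner {Σ} {L} Q T complete q′ = mk⇔ to from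
  where
  at : Point Σ L → ℕ → List (PointedInstance Σ)
  at t i = if does (any? (¬? ∘ refutes? t) Q) then [] else (canonical T , i) ∷ []
  to : Any (_⊨ q′) (members Q T) → All (λ q → ¬ (q′ entails q)) Q
  to p with find p
  ... | 𝒜a , 𝒜a∈ , sat with ∈-gather⁻ at T 𝒜a∈
  ...   | t , i , at-i , r with ∈-unless⁻ (any? (¬? ∘ refutes? t) Q) r
  ...     | ¬missing , here refl = All.map
    (λ {q} refuted ent → sound q at-i (ent _ sat) refuted)
    (All.map (λ {q} → decidable-stable (refutes? t q)) (All.¬Any⇒All¬ Q ¬missing))
  from : All (λ q → ¬ (q′ entails q)) Q → Any (_⊨ q′) (members Q T)
  from h = decidable-stable (any? (λ { (𝒜 , a) → ⊨? q′ 𝒜 a }) (members Q T)) λ ¬p →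
    complete q′ h λ { (t , i , at-i , refuted , sat) → ¬p (lose
      (∈-gather⁺ at at-i (∈-unless⁺ (any? (¬? ∘ refutes? t) Q)
        (λ p → let q , q∈ , ¬r = find p in ¬r (All.lookup refuted q∈)) (here refl)))
      sat) }

-- Completeness

-- Entailment with a class `E` in place of a query. With inverse roles `E` also records what is
-- known about predecessors.
Necessary : (PointedInstance Σ → Set) → Query Σ L → Set
Necessary E q = ∀ 𝒜a → E 𝒜a → 𝒜a ⊨ q

Unnecessary : (PointedInstance Σ → Set) → Query Σ L → Set
Unnecessary E q = ¬ Necessary E q

-- Were all conjuncts necessary, `q` would be too. Which of them fails is not computable for
-- arbitrary `E`.
unnecessary-conjunct : ∀ {E : PointedInstance Σ → Set} (q : Query Σ L) → Unnecessary E q →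
                       ¬ ¬ (∃[ r ] (r ∈ conjuncts q × Unnecessary E r))
unnecessary-conjunct q ¬q k = ¬q λ 𝒜a h → conjuncts-⊨ q λ {r} r∈ →
  decidable-stable (⊨? r _ _) λ ¬r → k (r , r∈ , λ nec → ¬r (nec 𝒜a h))

module _ (l : List X) (ls : List (List X)) where

  skip : ∀ {t} → t ∈ selections ls → t ∈ selections (l ∷ ls)
  skip = ∈-++⁺ˡ

  select : ∀ {t} → x ∈ l → t ∈ selections ls → x ∷ t ∈ selections (l ∷ ls)
  select p q with ∈⇒At p | ∈⇒At q
  ... | _ , p′ | _ , q′ = ∈-++⁺ʳ (selections ls) (∈-gather⁺ _ p′ (∈-gather⁺ _ q′ (here refl)))

  ∈-selections⁻ : ∀ {t} → t ∈ selections (l ∷ ls) →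
    t ∈ selections ls ⊎ ∃[ x ] ∃[ u ] (x ∈ l × u ∈ selections ls × t ≡ x ∷ u)
  ∈-selections⁻ p with ∈-++⁻ (selections ls) p
  ... | inj₁ q = inj₁ q
  ... | inj₂ q with ∈-gather⁻ _ l q
  ...   | x , _ , at , r with ∈-gather⁻ _ (selections ls) r
  ...     | u , _ , at′ , here eq = inj₂ (x , u , At⇒∈ at , At⇒∈ at′ , eq)

-- Completeness without inverse roles

violates-⊆ : ∀ {S₀ : Role Σ ELI} {t u} (q : Query Σ L) → t ⊆ u → Violates S₀ u q → Violates S₀ t q
violates-⊆ (some S r) t⊆u (eq , ¬r) = eq , ¬r ∘ Any.map t⊆u

fwd-injective : ∀ {P P′} → encodeRole {Σ} {L} (fwd P) ≡ encodeRole {Σ} {ELI} (fwd P′) → P ≡ P′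
fwd-injective eq = encodeFin-injective (proj₂ (node-injective eq))

Successor : List (List (Query Σ EL)) → Fin (binary Σ) → Query Σ EL → Point Σ EL → Set
Successor ls P q t =
  ∃[ u ] (u ∈ selections ls × (∀ {r} → r ∈ u → Unnecessary (_⊨ q) r) × ¬ Any (Violates (fwd P) u) t)

-- Only an `x` of the form `some (fwd P) r` restricts the successor. Then `r` is not necessary for
-- `q`, hence neither is one of its conjuncts, and adding it to `u` makes `u` refute `r`. Since it
-- comes from the pool of `x`, one element per pool stays enough.
successor-∷ : ∀ {l ls P} {q : Query Σ EL} {t} → Closed l → ∀ x → x ∈ l →
  Unnecessary (_⊨ some (fwd P) q) x → Successor ls P q t → ¬ ¬ Successor (l ∷ ls) P q (x ∷ t)
successor-∷ {l = l} {ls} c top        x∈ ¬x (u , u∈ , ¬u , ok) k = k (u , skip l ls u∈ , ¬u , λ { (there p) → ok p })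
successor-∷ {l = l} {ls} c (atom A)   x∈ ¬x (u , u∈ , ¬u , ok) k = k (u , skip l ls u∈ , ¬u , λ { (there p) → ok p })
successor-∷ {l = l} {ls} c (q₁ ∧ q₂)  x∈ ¬x (u , u∈ , ¬u , ok) k = k (u , skip l ls u∈ , ¬u , λ { (there p) → ok p })
successor-∷ {Σ} {l} {ls} {P} c (some (fwd P′) r) x∈ ¬x (u , u∈ , ¬u , ok) k with P′ Fin.≟ P
... | no P′≢P = k (u , skip l ls u∈ , ¬u , λ { (here (eq , _)) → P′≢P (fwd-injective {Σ} {EL} eq) ; (there p) → ok p })
... | yes refl = unnecessary-conjunct r
  (λ nec → ¬x λ { (𝒜 , _) (b , p , h) → b , p , nec (𝒜 , b) h })
  λ { (y , y∈ , ¬y) → k (y ∷ u , select l ls (c x∈ y∈) u∈ , (λ { (here refl) → ¬y ; (there p) → ¬u p })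
     , λ { (here (_ , ¬ref)) → ¬ref (lose y∈ (here refl))
         ; (there p) → ok (Any.map (λ {z} → violates-⊆ z there) p) }) }

successor : ∀ {ls t} P (q : Query Σ EL) → All Closed ls → t ∈ selections ls →
  (∀ {r} → r ∈ t → Unnecessary (_⊨ some (fwd P) q) r) → ¬ ¬ Successor ls P q t
successor P q [] (here refl) ¬t k = k ([] , here refl , (λ ()) , λ ())
successor {ls = l ∷ ls} P q (c ∷ cs) t∈ ¬t k with ∈-selections⁻ l ls t∈
... | inj₁ t∈′ = successor P q cs t∈′ ¬t λ { (u , u∈ , rest) → k (u , skip l ls u∈ , rest) }
... | inj₂ (x , t′ , x∈ , t∈′ , refl) = successor P q cs t∈′ (¬t ∘ there) λ s →
  successor-∷ {ls = ls} c x x∈ (¬t (here refl)) s k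

no-inverse : ∀ {P} {t u : Point Σ EL} → ¬ Any (Violates (inv P) t) u
no-inverse p with Any.satisfied p
... | some (fwd _) _ , () , _

complete-EL : ∀ {ls : List (List (Query Σ EL))} → All Closed ls → ∀ q {t i} → At (selections ls) t i →
  (∀ {r} → r ∈ t → Unnecessary (_⊨ q) r) → ¬ ¬ ((canonical (selections ls) , i) ⊨ q)
complete-EL cs top      at ¬t k = k tt
complete-EL cs (atom A) at ¬t k = k (concept∈⁺ at λ p → ¬t p λ _ h → h)
complete-EL cs (q₁ ∧ q₂) at ¬t k =
  complete-EL cs q₁ at (λ p nec → ¬t p λ 𝒜a h → nec 𝒜a (proj₁ h)) λ h₁ →
  complete-EL cs q₂ at (λ p nec → ¬t p λ 𝒜a h → nec 𝒜a (proj₂ h)) λ h₂ → k (h₁ , h₂)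
complete-EL cs (some (fwd P) q) at ¬t k =
  successor P q cs (At⇒∈ at) ¬t λ { (u , u∈ , ¬u , ok) →
  let j , at′ = ∈⇒At u∈ in
  complete-EL cs q at′ ¬u λ h → k (j , role∈⁺ at at′ (ok , no-inverse) , h) }

separatePools-closed : (Q : List (Query Σ L)) → All Closed (separatePools Q)
separatePools-closed []      = []
separatePools-closed (q ∷ Q) = subqueries-closed q ∷ separatePools-closed Q

refuting-selection : ∀ {E : PointedInstance Σ → Set} (Q : List (Query Σ L)) → All (Unnecessary E) Q →
  ¬ ¬ (∃[ t ] (t ∈ selections (separatePools Q) × (∀ {r} → r ∈ t → Unnecessary E r) × All (Refutes t) Q))
refuting-selection []      []        k = k ([] , here refl , (λ ()) , [])
refuting-selection (q ∷ Q) (¬q ∷ ¬Q) k =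
  unnecessary-conjunct q ¬q λ { (y , y∈ , ¬y) →
  refuting-selection Q ¬Q λ { (t , t∈ , ¬t , ref) →
  k (y ∷ t , select (subqueries q) (separatePools Q) (conjuncts⊆subqueries q y∈) t∈ , (λ { (here refl) → ¬y ; (there p) → ¬t p })
    , lose y∈ (here refl) ∷ All.map (Any.map there) ref) } }

split-partner-EL : (Q : List (Query Σ EL)) → IsSplitPartner Q (members Q (selections (separatePools Q)))
split-partner-EL Q = split-partner Q (selections (separatePools Q)) λ q′ ¬Q k →
  refuting-selection Q ¬Q λ { (t , t∈ , ¬t , ref) →
  let i , at = ∈⇒At t∈ in
  complete-EL (separatePools-closed Q) q′ at ¬t λ h → k (t , i , at , ref , h) }

-- Completeness with inverse roles

Singletons : List X → List (List X)
Singletons = gather λ x _ → (x ∷ []) ∷ []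

-- `t` has to be exact: an edge must be permitted from both ends, so each end contains only
-- unnecessary queries, but also enough of them to refute what the other end demands.
record Type (l t : Point Σ L) (E : PointedInstance Σ → Set) : Set where
  field
    selected    : t ∈ selections (Singletons l)
    within      : t ⊆ l
    unnecessary : ∀ {r} → r ∈ t → Unnecessary E r
    maximal     : ∀ {r} → r ∈ l → Unnecessary E r → r ∈ t

open Type

type-exists : ∀ (l : Point Σ L) E → ¬ ¬ (∃[ t ] Type l t E)
type-exists []      E k = k ([] , record { selected = here refl ; within = λ () ; unnecessary = λ () ; maximal = λ () })
type-exists (x ∷ l) E k = type-exists l E λ { (t , ty) → ¬¬-excluded-middle λ
  { (yes nec) → k (t , record
      { selected    = skip (x ∷ []) (Singletons l) (selected ty)
      ; within      = there ∘ within ty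
      ; unnecessary = unnecessary ty
      ; maximal     = λ { (here refl) ¬r → ⊥-elim (¬r nec) ; (there p) → maximal ty p } })
  ; (no ¬nec) → k (x ∷ t , record
      { selected    = select (x ∷ []) (Singletons l) (here refl) (selected ty)
      ; within      = λ { (here eq) → here eq ; (there p) → there (within ty p) }
      ; unnecessary = λ { (here refl) → ¬nec ; (there p) → unnecessary ty p }
      ; maximal     = λ { (here refl) _ → here refl ; (there p) ¬r → there (maximal ty p ¬r) } }) } }

type-cong : ∀ {l t : Point Σ L} {E F} → (∀ {𝒜a} → E 𝒜a → F 𝒜a) → (∀ {𝒜a} → F 𝒜a → E 𝒜a) →
            Type l t E → Type l t F
type-cong f g ty = record
  { selected = selected ty ; within = within ty
  ; unnecessary = λ p nec → unnecessary ty p λ 𝒜a h → nec 𝒜a (f h)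
  ; maximal = λ p ¬r → maximal ty p λ nec → ¬r λ 𝒜a h → nec 𝒜a (g h) }

type-refutes : ∀ {l t : Point Σ L} {E} q → Type l t E → conjuncts q ⊆ l → Unnecessary E q → Refutes t q
type-refutes {t = t} q ty c ¬q = decidable-stable (refutes? t q) λ ¬ref → ¬q λ 𝒜a h → conjuncts-⊨ q λ {y} y∈ →
  decidable-stable (⊨? y _ _) λ ¬y → ¬ref (lose y∈ (maximal ty (c y∈) λ nec → ¬y (nec 𝒜a h)))

-- Were `r` necessary for `F`, `some S r` would be necessary for `E` and not in `t`. So a conjunct
-- of `r` is unnecessary for `F`, and `u`, being maximal, contains it.
types-compatible : ∀ {l t u : Point Σ ELI} {E F S} → Closed l → Type l t E → Type l u F →
  (∀ r → Necessary F r → Necessary E (some S r)) → ¬ Any (Violates S u) t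
types-compatible {S = S} c ty ty′ step p with find p
... | some S′ r , r∈ , eq , ¬ref with encodeRole-injective {S = S′} {S} eq
...   | refl = ¬ref (type-refutes r ty′ (c (within ty r∈)) (unnecessary ty r∈ ∘ step r))

_⁻ : Role Σ ELI → Role Σ ELI
fwd P ⁻ = inv P
inv P ⁻ = fwd P

roleFact-⁻ : ∀ (S : Role Σ ELI) a b → roleFact (S ⁻) b a ≡ roleFact S a b
roleFact-⁻ (fwd P) a b = refl
roleFact-⁻ (inv P) a b = refl

edge : ∀ {T : List (Point Σ ELI)} S {t u} → At T t i → At T u j →
       ¬ Any (Violates S u) t → ¬ Any (Violates (S ⁻) t) u → roleFact S i j ∈ canonical T
edge (fwd P) at at′ p q = role∈⁺ at at′ (p , q)
edge (inv P) at at′ p q = role∈⁺ at′ at (q , p)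

module _ {l : Point Σ ELI} (closed-l : Closed l) where

  private
    T : List (Point Σ ELI)
    T = selections (Singletons l)

  -- C describes what is known of an element before q is required of it;
  -- for a successor this includes what is known of its predecessor.
  complete-ELI : ∀ q C {t i} → At T t i → Type l t (λ 𝒜a → C 𝒜a × 𝒜a ⊨ q) →
                 ¬ ¬ ((canonical T , i) ⊨ q)
  complete-ELI top      C at ty k = k tt
  complete-ELI (atom A) C at ty k = k (concept∈⁺ at λ p → unnecessary ty p λ _ → proj₂)
  complete-ELI (q₁ ∧ q₂) C at ty k =
    -- The other conjunct moves into the context, so that the class, and with it the point, is the
    -- same for both.
    complete-ELI q₁ (λ 𝒜a → C 𝒜a × 𝒜a ⊨ q₂) at
      (type-cong (λ { (c , h₁ , h₂) → (c , h₂) , h₁ }) (λ { ((c , h₂) , h₁) → c , h₁ , h₂ }) ty) λ h₁ →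
    complete-ELI q₂ (λ 𝒜a → C 𝒜a × 𝒜a ⊨ q₁) at
      (type-cong (λ { (c , h₁ , h₂) → (c , h₁) , h₂ }) (λ { ((c , h₁) , h₂) → c , h₁ , h₂ }) ty) λ h₂ →
    k (h₁ , h₂)
  complete-ELI (some S q) C {t} {i} at ty k = type-exists l E′ λ { (u , ty′) →
    let j , at′ = ∈⇒At (selected ty′) in
    complete-ELI q C′ at′ ty′ λ h → k (j , edge S at at′ 
      (types-compatible closed-l ty ty′ λ { r nec (𝒜 , a) (c , b , p , h′) → b , p , nec (𝒜 , b) ((a , p , c) , h′) })
      -- Backwards: the predecessor recorded in `C′` satisfies `some S q`, the element itself being
      -- the witness, and so lies in `E`.
      (types-compatible closed-l ty′ ty λ { r nec (𝒜 , b) ((a , p , c) , h′) →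
        a , subst (_∈ 𝒜) (sym (roleFact-⁻ S a b)) p , nec (𝒜 , a) (c , b , p , h′) }) , h) }
    where
    C′ E E′ : PointedInstance Σ → Set
    C′ (𝒜 , b) = ∃[ a ] (roleFact S a b ∈ 𝒜 × C (𝒜 , a))
    E  𝒜a      = C 𝒜a × 𝒜a ⊨ some S q
    E′ 𝒜a      = C′ 𝒜a × 𝒜a ⊨ q

pool-closed : (Q : List (Query Σ L)) → Closed (gather (λ q _ → subqueries q) Q)
pool-closed (q ∷ Q) p y∈ with ∈-++⁻ (subqueries q) p
... | inj₁ p′ = ∈-++⁺ˡ (subqueries-closed q p′ y∈)
... | inj₂ p′ = ∈-++⁺ʳ (subqueries q) (pool-closed Q p′ y∈)

split-partner-ELI : (Q : List (Query Σ ELI)) → IsSplitPartner Q (members Q (selections (commonPool Q)))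
split-partner-ELI {Σ} Q = split-partner Q (selections (commonPool Q)) λ q′ ¬Q k →
  type-exists l (λ 𝒜a → ⊤ × 𝒜a ⊨ q′) λ { (t , ty) →
  let i , at = ∈⇒At (selected ty) in
  complete-ELI (pool-closed Q) q′ (λ _ → ⊤) at ty λ h → k (t , i , at
    , All.tabulate (λ {q} q∈ → type-refutes q ty
        (λ y∈ → ∈-gather⁺ _ (proj₂ (∈⇒At q∈)) (conjuncts⊆subqueries q y∈))
        (λ nec → All.lookup ¬Q q∈ λ 𝒜a h → nec 𝒜a (tt , h)))
    , h) }
  where
  l : Point Σ ELI
  l = gather (λ q _ → subqueries q) Q

-- The lower bound

n<2^n : ∀ n → n < 2 ^ n
n<2^n zero    = s≤s z≤n
n<2^n (suc n) = +-mono-≤ (m^n>0 2 n) (≤-trans (n<2^n n) (m≤m+n (2 ^ n) 0))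

-- Wasteful, but a constant then costs only a constant degree.
const≤pw : ∀ c x → c ≤ pw c x
const≤pw c x = ≤-trans (<⇒≤ (n<2^n c))
  (≤-trans (^-monoˡ-≤ c {2} {2 + x} (m≤m+n 2 x)) (≤-reflexive (sym (pw-def c x))))

eval≤pw : ∀ f → ∃[ d ] (∀ x → eval f x ≤ pw d x)
eval≤pw []      = 0 , λ x → z≤n
eval≤pw (c ∷ f) with eval≤pw f
... | d , bound = _ , λ x → pw-+ {c} {1 + d} x (const≤pw c x) (pw-* {1} x (≤pw₁ x) (bound x))

opaque
  -- For n a power of two with exponent `e + e`, the left side is at most `2 ^ ((4 + (e + e)) * d)`,
  -- because `6 + 8 * n ≤ 16 * n`. The choice `e = 4 + (d + d)` puts this exponent below the square
  -- of `1 + e`, which is at most n.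
  exponential-beats-power : ∀ d → ∃[ n ] (0 < n × pw d (4 + 8 * n) < 2 ^ n)
  exponential-beats-power d = 2 ^ (e + e) , m^n>0 2 (e + e) , (begin-strict
    pw d (4 + 8 * 2 ^ (e + e))      ≡⟨ pw-def d _ ⟩
    (6 + 8 * 2 ^ (e + e)) ^ d       ≤⟨ ^-monoˡ-≤ d (linear (2 ^ (e + e)) (m^n>0 2 (e + e))) ⟩
    (16 * 2 ^ (e + e)) ^ d          ≡⟨ cong (_^ d) (^-distribˡ-+-* 2 4 (e + e)) ⟨
    (2 ^ (4 + (e + e))) ^ d         ≡⟨ ^-*-assoc 2 (4 + (e + e)) d ⟩
    2 ^ ((4 + (e + e)) * d)         <⟨ ^-monoʳ-< 2 ≤-refl square ⟩
    2 ^ (2 ^ (e + e))               ∎)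
    where
    open ≤-Reasoning
    e : ℕ
    e = 4 + (d + d)
    linear : ∀ x → 1 ≤ x → 6 + 8 * x ≤ 16 * x
    linear x 1≤x = ≤-trans (+-monoˡ-≤ (8 * x) (≤-trans (m≤m+n 6 2) (*-monoʳ-≤ 8 1≤x))) (≤-reflexive (twice x))
      where
      twice : ∀ x → 8 * x + 8 * x ≡ 16 * x
      twice = solve-∀
    square : (4 + (e + e)) * d < 2 ^ (e + e)
    square = begin-strict
      (4 + (e + e)) * d                     <⟨ s≤s (m≤m+n _ _) ⟩
      -- `8 * d + 24` completes the square.
      suc ((4 + (e + e)) * d + (8 * d + 24)) ≡⟨ expand d ⟩
      suc e * suc e                         ≤⟨ *-mono-≤ (n<2^n e) (n<2^n e) ⟩
      2 ^ e * 2 ^ e                         ≡⟨ ^-distribˡ-+-* 2 e e ⟨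
      2 ^ (e + e)                           ∎
      where
      expand : ∀ d → 1 + ((4 + ((4 + (d + d)) + (4 + (d + d)))) * d + (8 * d + 24)) ≡ (1 + (4 + (d + d))) * (1 + (4 + (d + d)))
      expand = solve-∀

⋀ : ∀ {n} → (Fin n → Query Σ L) → Query Σ L
⋀ {n = zero}  q = top
⋀ {n = suc n} q = q zero ∧ ⋀ (q ∘ suc)

⋀⁺ : ∀ {n} {q : Fin n → Query Σ L} {𝒜a} → (∀ i → 𝒜a ⊨ q i) → 𝒜a ⊨ ⋀ q
⋀⁺ {n = zero}  h = tt
⋀⁺ {n = suc n} h = h zero , ⋀⁺ (h ∘ suc)

⋀⁻ : ∀ {n} {q : Fin n → Query Σ L} {𝒜a} → 𝒜a ⊨ ⋀ q → ∀ i → 𝒜a ⊨ q i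
⋀⁻ {n = suc n} (h , _) zero    = h
⋀⁻ {n = suc n} (_ , h) (suc i) = ⋀⁻ h i

size-⋀ : ∀ {n s} {q : Fin n → Query Σ L} → (∀ i → ∣ q i ∣ ≡ s) → ∣ ⋀ q ∣ ≡ 1 + n * (1 + s)
size-⋀ {n = zero}  h = refl
size-⋀ {n = suc n} {s} {q} h = trans (cong suc (cong₂ _+_ (h zero) (size-⋀ (h ∘ suc)))) (shift s (n * (1 + s)))
  where
  shift : ∀ s m → 1 + (s + (1 + m)) ≡ 1 + (1 + s + m)
  shift = solve-∀

finToFun-injective : ∀ {m n} {x y : Fin (m ^ n)} → (∀ i → finToFun {m} {n} x i ≡ finToFun y i) → x ≡ y
finToFun-injective {m} {n} {x} {y} h =
  trans (sym (Fin.funToFin-finToFin {n} {m} x)) (trans (funToFin-cong h) (Fin.funToFin-finToFin {n} {m} y))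
  where
  funToFin-cong : ∀ {n} {f g : Fin n → Fin m} → (∀ i → f i ≡ g i) → funToFin f ≡ funToFin g
  funToFin-cong {zero}  h = refl
  funToFin-cong {suc n} h = cong₂ combine (h zero) (funToFin-cong (h ∘ suc))

module Lower (n : ℕ) where

  Sig : Signature
  Sig = record { unary = 2 * n ; binary = 1 ; nonempty = m≤n+m 1 (2 * n) }

  R R⁻ : Role Sig ELI
  R  = fwd zero
  R⁻ = inv zero

  opaque
    mark : Fin 2 → Fin n → Fin (unary Sig)
    mark = combine

    mark-injective : ∀ {b i c j} → mark b i ≡ mark c j → b ≡ c × i ≡ j
    mark-injective = Fin.combine-injective _ _ _ _

  label : Fin 2 → Fin n → Query Sig ELI
  label b i = atom (mark b i)

  both : Fin n → Query Sig ELI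
  both i = label zero i ∧ label (suc zero) i

  query : Query Sig ELI
  query = some R (⋀ λ i → some R⁻ (both i))

  size-query : ∣ query ∣ + ∣ Sig ∣ₛ ≡ 4 + 8 * n
  size-query = trans (cong (λ s → 2 + s + (2 * n + 1)) (size-⋀ {s = 5} {q = λ i → some R⁻ (both i)} (λ _ → refl))) (sum-up n)
    where
    sum-up : ∀ n → 2 + (1 + n * 6) + (2 * n + 1) ≡ 4 + 8 * n
    sum-up = solve-∀

  bothUnless : Fin n → Fin n → Query Sig ELI
  bothUnless i j = if does (i Fin.≟ j) then top else both j

  choice : (Fin n → Fin 2) → Query Sig ELI
  choice I = (⋀ λ i → label (I i) i) ∧ ⋀ λ i → some R (some R⁻ (⋀ (bothUnless i)))

  two : ∀ {x y : Fin 2} → x ≢ y → ∀ b → b ≡ x ⊎ b ≡ y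
  two {zero}     {zero}     x≢y b          = ⊥-elim (x≢y refl)
  two {zero}     {suc zero} x≢y zero       = inj₁ refl
  two {zero}     {suc zero} x≢y (suc zero) = inj₂ refl
  two {suc zero} {zero}     x≢y zero       = inj₂ refl
  two {suc zero} {zero}     x≢y (suc zero) = inj₁ refl
  two {suc zero} {suc zero} x≢y b          = ⊥-elim (x≢y refl)

  -- If I and J differ at i, the point has both labels with index i, and
  -- the R-successor that choice I provides for i has a predecessor with all
  -- the other labels.
  choices-meet : ∀ {𝒜a I J i} → I i ≢ J i → 𝒜a ⊨ choice I → 𝒜a ⊨ choice J → 𝒜a ⊨ query
  choices-meet {𝒜 , a} {I} {J} {i} I≢J (labelsI , rest) (labelsJ , _) with ⋀⁻ rest i
  ... | b , Rab , c , Rcb , others = b , Rab , ⋀⁺ satisfied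
    where
    labelled : ∀ k → (𝒜 , a) ⊨ label k i
    labelled k with two I≢J k
    ... | inj₁ refl = ⋀⁻ {q = λ i → label (I i) i} labelsI i
    ... | inj₂ refl = ⋀⁻ {q = λ i → label (J i) i} labelsJ i
    satisfied : ∀ j → (𝒜 , b) ⊨ some R⁻ (both j)
    satisfied j with i Fin.≟ j | ⋀⁻ {q = bothUnless i} others j
    ... | yes refl | _ = a , Rab , labelled zero , labelled (suc zero)
    ... | no _     | h = c , Rcb , h

  element : Fin n → Individual
  element i = suc (toℕ i)

  -- By its loop `element i` is its own predecessor, so it serves both as the successor and as the
  -- predecessor that `choice I` demands for `i`.
  around : (Fin n → Fin 2) → Fin n → List (Fact Sig)
  around I i = concept (mark (I i) i) 0 ∷ role zero 0 (element i) ∷ role zero (element i) (element i) ∷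
    gatherFin λ j → if does (i Fin.≟ j) then [] else
      concept (mark zero j) (element i) ∷ concept (mark (suc zero) j) (element i) ∷ []

  model : (Fin n → Fin 2) → Instance Sig
  model I = gatherFin (around I)

  module _ (I : Fin n → Fin 2) where

    model-choice : (model I , 0) ⊨ choice I
    model-choice = ⋀⁺ (λ i → ∈-gatherFin⁺ (around I) i (here refl)) , ⋀⁺ λ i →
      element i , ∈-gatherFin⁺ (around I) i (there (here refl)) ,
      element i , ∈-gatherFin⁺ (around I) i (there (there (here refl))) , ⋀⁺ (others i)
      where
      others : ∀ i j → (model I , element i) ⊨ bothUnless i j
      others i j with i Fin.≟ j in eq
      ... | yes _ = tt
      ... | no i≢j = fact (here refl) , fact (there (here refl))
        where
        fact : ∀ {f} → f ∈ concept (mark zero j) (element i) ∷ concept (mark (suc zero) j) (element i) ∷ [] →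
               f ∈ model I
        fact p = ∈-gatherFin⁺ (around I) i (there (there (there
          (∈-gatherFin⁺ _ j (∈-unless⁺ (i Fin.≟ j) i≢j p)))))

    Labelled : Fin 2 → Fin n → Individual → Set
    Labelled b i a = (b ≡ I i × a ≡ 0) ⊎ ∃[ k ] (k ≢ i × a ≡ element k)

    labels : ∀ {b i a} → concept (mark b i) a ∈ model I → Labelled b i a
    labels {b} {i} p with ∈-gatherFin⁻ (around I) p
    ... | k , q = at q refl
      where
      injective : ∀ {A B : Fin (unary Sig)} {a c} → concept {Sig} A a ≡ concept B c → A ≡ B × a ≡ c
      injective refl = refl , refl
      at : ∀ {f a} → f ∈ around I k → f ≡ concept (mark b i) a → Labelled b i a
      at (here refl) eq with injective eq
      ... | eq′ , refl with mark-injective eq′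
      ...   | refl , refl = inj₁ (refl , refl)
      at (there (here refl)) ()
      at (there (there (here refl))) ()
      at (there (there (there q))) eq with ∈-gatherFin⁻ _ q
      ... | j , r with ∈-unless⁻ (k Fin.≟ j) r
      ...   | k≢j , here refl with injective eq
      ...     | eq′ , refl with mark-injective eq′
      ...       | refl , refl = inj₂ (k , k≢j , refl)
      at (there (there (there q))) eq | j , r | k≢j , there (here refl) with injective eq
      ...     | eq′ , refl with mark-injective eq′
      ...       | refl , refl = inj₂ (k , k≢j , refl)

    edges : ∀ {a b} → role zero a b ∈ model I → ∃[ i ] ((a ≡ 0 ⊎ a ≡ element i) × b ≡ element i)
    edges p with ∈-gatherFin⁻ (around I) p
    ... | k , there (here refl) = k , inj₁ refl , refl
    ... | k , there (there (here refl)) = k , inj₂ refl , refl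
    ... | k , there (there (there q)) with ∈-gatherFin⁻ _ q
    ...   | j , r with ∈-unless⁻ (k Fin.≟ j) r
    ...     | _ , here ()
    ...     | _ , there (here ())

    element-injective : ∀ {i j} → element i ≡ element j → i ≡ j
    element-injective eq = Fin.toℕ-injective (suc-injective eq)

    -- The predecessors of `element i` are 0, which has just one of the two labels with index `i`,
    -- and `element i`, which has neither.
    model-query : ¬ ((model I , 0) ⊨ query)
    model-query (_ , p , h) with edges p
    ... | i , _ , refl with ⋀⁻ {q = λ i → some R⁻ (both i)} h i
    ...   | c , p′ , h₀ , h₁ with edges p′
    ...     | k , c≡ , eq with element-injective eq
    ...       | refl = contradict c≡ (labels h₀) (labels h₁)
      where
      contradict : ∀ {c i} → c ≡ 0 ⊎ c ≡ element i → Labelled zero i c → Labelled (suc zero) i c → ⊥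
      contradict _ (inj₁ (eq₀ , _)) (inj₁ (eq₁ , _)) with trans eq₀ (sym eq₁)
      ... | ()
      contradict (inj₁ refl) (inj₁ _) (inj₂ (_ , _ , ()))
      contradict (inj₁ refl) (inj₂ (_ , _ , ())) _
      contradict (inj₂ refl) (inj₂ (k , k≢i , eq)) _ = k≢i (sym (element-injective eq))
      contradict (inj₂ refl) (inj₁ (_ , ())) _

  -- Members without facts add nothing to `totalSize`, so they are removed before members are
  -- counted. For `0 < n` no `choice I` is satisfied by them.
  nonempty? : Decidable {A = PointedInstance Sig} (λ 𝒜a → 1 ≤ numFacts (proj₁ 𝒜a))
  nonempty? (𝒜 , _) = 1 ≤? numFacts 𝒜

  length≤totalSize : ∀ S → length (filter nonempty? S) ≤ totalSize S
  length≤totalSize [] = z≤n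
  length≤totalSize (𝒜a ∷ S) = step (nonempty? 𝒜a)
    where
    step : Dec (1 ≤ numFacts (proj₁ 𝒜a)) → length (filter nonempty? (𝒜a ∷ S)) ≤ totalSize (𝒜a ∷ S)
    step (yes 1≤) rewrite filter-accept nonempty? {x = 𝒜a} {xs = S} 1≤ = +-mono-≤ 1≤ (length≤totalSize S)
    step (no 1≰)  rewrite filter-reject nonempty? {x = 𝒜a} {xs = S} 1≰ =
      ≤-trans (length≤totalSize S) (m≤n+m _ (numFacts (proj₁ 𝒜a)))

  lower-bound : 0 < n → ∀ S → IsSplitPartner (query ∷ []) S → 2 ^ n ≤ totalSize S
  lower-bound 0<n S split = ≤-trans (Fin.injective⇒≤ {f = position} injective) (length≤totalSize S)
    where
    open Equivalence
    at : Fin (2 ^ n) → Fin n → Fin 2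
    at = finToFun
    inhabited : ∀ {𝒜a : PointedInstance Sig} {I} → 𝒜a ⊨ choice I → 1 ≤ numFacts (proj₁ 𝒜a)
    inhabited {[] , _} {I} (h , _) with ⋀⁻ {q = λ i → label (I i) i} h (fromℕ< 0<n)
    ... | ()
    inhabited {_ ∷ _ , _} _ = s≤s z≤n
    found : ∀ x → Any (_⊨ choice (at x)) (filter nonempty? S)
    found x with find (from (split (choice (at x))) ((λ ent → model-query (at x) (ent _ (model-choice (at x)))) ∷ []))
    ... | 𝒜a , p , h = lose (∈-filter⁺ nonempty? p (inhabited {𝒜a} {at x} h)) h
    position : Fin (2 ^ n) → Fin (length (filter nonempty? S))
    position x = Any.index (found x)
    injective : ∀ {x y} → position x ≡ position y → x ≡ y
    injective {x} {y} eq with x Fin.≟ y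
    ... | yes x≡y = x≡y
    ... | no x≢y with Fin.¬∀⟶∃¬ n (λ i → at x i ≡ at y i) (λ i → at x i Fin.≟ at y i) (x≢y ∘ finToFun-injective)
    -- The common member satisfies `query`, so by the split property `query` would not entail
    -- itself.
    ...   | i , differ = ⊥-elim (All.head (to (split query) (lose
      (proj₁ (∈-filter⁻ nonempty? (∈-lookup (position x))))
      (choices-meet {I = at x} {at y} differ (Any.lookup-index (found x))
        (subst (λ k → Data.List.lookup (filter nonempty? S) k ⊨ choice (at y)) (sym eq) (Any.lookup-index (found y))))))
      λ _ h → h)

exceeds : ∀ f d n → (∀ x → eval f x ≤ pw d x) → 0 < n → pw d (4 + 8 * n) < 2 ^ n →
  ¬ (∃[ S ] (IsSplitPartner (Lower.query n ∷ []) S × totalSize S ≤ eval f (∣ Lower.query n ∣ + ∣ Lower.Sig n ∣ₛ)))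
exceeds f d n f≤ 0<n beaten (S , split , S≤) = <⇒≱ beaten (begin
  2 ^ n                         ≤⟨ lower-bound 0<n S split ⟩
  totalSize S                   ≤⟨ S≤ ⟩
  eval f (∣ query ∣ + ∣ Sig ∣ₛ) ≡⟨ cong (eval f) size-query ⟩
  eval f (4 + 8 * n)            ≤⟨ f≤ _ ⟩
  pw d (4 + 8 * n)              ∎)
  where
  open Lower n
  open ≤-Reasoning

no-polynomial-bound : ¬ (∃[ f ] ((Σ : Signature) (q : Query Σ ELI) →
  ∃[ S ] (IsSplitPartner (q ∷ []) S × totalSize S ≤ eval f (∣ q ∣ + ∣ Σ ∣ₛ))))
no-polynomial-bound (f , small) =
  let d , f≤ = eval≤pw f
      n , 0<n , beaten = exponential-beats-power d
  in exceeds f d n f≤ 0<n beaten (small (Lower.Sig n) (Lower.query n))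

-- The upper bounds

_⊕_ : Polynomial → Polynomial → Polynomial
[]      ⊕ q       = q
(c ∷ p) ⊕ []      = c ∷ p
(c ∷ p) ⊕ (d ∷ q) = (c + d) ∷ (p ⊕ q)

eval-⊕ : ∀ p q x → eval (p ⊕ q) x ≡ eval p x + eval q x
eval-⊕ []      q       x = refl
eval-⊕ (c ∷ p) []      x = sym (+-identityʳ _)
eval-⊕ (c ∷ p) (d ∷ q) x = trans (cong (λ y → c + d + x * y) (eval-⊕ p q x)) (rearrange c d x (eval p x) (eval q x))
  where
  rearrange : ∀ c d x y z → c + d + x * (y + z) ≡ (c + x * y) + (d + x * z)
  rearrange = solve-∀

opaque
  pw≤eval : ∀ d → ∃[ f ] (∀ x → pw d x ≤ eval f x)
  pw≤eval zero = 1 ∷ [] , λ x → ≤-trans (≤-reflexive (pw-def 0 x)) (m≤m+n 1 (x * 0))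
  pw≤eval (suc d) with pw≤eval d
  ... | f , bound = (f ⊕ f) ⊕ (0 ∷ f) , λ x → begin
    pw (suc d) x                          ≡⟨ pw-suc d x ⟩
    (2 + x) * pw d x                      ≤⟨ *-monoʳ-≤ (2 + x) (bound x) ⟩
    (2 + x) * eval f x                    ≡⟨ distribute x (eval f x) ⟩
    (eval f x + eval f x) + x * eval f x  ≡⟨ cong (_+ x * eval f x) (eval-⊕ f f x) ⟨
    eval (f ⊕ f) x + eval (0 ∷ f) x       ≡⟨ eval-⊕ (f ⊕ f) (0 ∷ f) x ⟨
    eval ((f ⊕ f) ⊕ (0 ∷ f)) x            ∎
    where
    open ≤-Reasoning
    distribute : ∀ x y → (2 + x) * y ≡ (y + y) + x * y
    distribute = solve-∀

size-encodeℕ : ∀ n → treeSize (encodeℕ n) ≡ 1 + 2 * n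
size-encodeℕ zero    = refl
size-encodeℕ (suc n) = trans (cong (2 +_) (size-encodeℕ n)) (double n)
  where
  double : ∀ n → 2 + (1 + 2 * n) ≡ 1 + 2 * (1 + n)
  double = solve-∀

size-encodeFin : ∀ {n} (i : Fin n) → treeSize (encodeFin i) ≤ 1 + 2 * n
size-encodeFin i = ≤-trans (≤-reflexive (size-encodeℕ (toℕ i))) (s≤s (*-monoʳ-≤ 2 (<⇒≤ (Fin.toℕ<n i))))

query-size>0 : (q : Query Σ L) → 1 ≤ ∣ q ∣
query-size>0 top        = ≤-refl
query-size>0 (atom A)   = ≤-refl
query-size>0 (q₁ ∧ q₂)  = s≤s z≤n
query-size>0 (some S q) = s≤s z≤n

module _ {Σ : Signature} where

  private
    m B : ℕ
    m = ∣ Σ ∣ₛ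
    B = 12 + 2 * m

  size-encodeRole : (S : Role Σ L) → treeSize (encodeRole S) ≤ 5 + 2 * m
  size-encodeRole (fwd P) = ≤-trans (+-monoʳ-≤ 2 (size-encodeFin P))
    (≤-trans (+-monoʳ-≤ 3 (*-monoʳ-≤ 2 (m≤n+m (binary Σ) (unary Σ)))) (m≤n+m _ 2))
  size-encodeRole (inv P) = +-monoʳ-≤ 4 (≤-trans (size-encodeFin P)
    (+-monoʳ-≤ 1 (*-monoʳ-≤ 2 (m≤n+m (binary Σ) (unary Σ)))))

  -- `B` leaves room for a tag and a unary symbol number, so every symbol of `q` can pay for its
  -- share of the encoding.
  size-encodeQuery : (q : Query Σ L) → treeSize (encodeQuery q) ≤ ∣ q ∣ * B
  size-encodeQuery top = m≤m+n 3 _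
  size-encodeQuery (atom A) = begin
    4 + treeSize (encodeFin A)   ≤⟨ +-monoʳ-≤ 4 (size-encodeFin A) ⟩
    5 + 2 * unary Σ              ≤⟨ +-mono-≤ (m≤m+n 5 7) (*-monoʳ-≤ 2 (m≤m+n (unary Σ) (binary Σ))) ⟩
    B                            ≡⟨ +-identityʳ B ⟨
    1 * B                        ∎
    where open ≤-Reasoning
  size-encodeQuery (q₁ ∧ q₂) = begin
    7 + (treeSize (encodeQuery q₁) + treeSize (encodeQuery q₂)) ≤⟨ +-mono-≤ (m≤m+n 7 (5 + 2 * m))
                                                                    (+-mono-≤ (size-encodeQuery q₁) (size-encodeQuery q₂)) ⟩
    B + (∣ q₁ ∣ * B + ∣ q₂ ∣ * B)    ≡⟨ cong (B +_) (*-distribʳ-+ B ∣ q₁ ∣ ∣ q₂ ∣) ⟨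
    ∣ q₁ ∧ q₂ ∣ * B                  ∎
    where open ≤-Reasoning
  size-encodeQuery (some S q) = begin
    9 + (treeSize (encodeRole S) + treeSize (encodeQuery q)) ≤⟨ +-monoʳ-≤ 9 (+-mono-≤ (size-encodeRole S) (size-encodeQuery q)) ⟩
    9 + ((5 + 2 * m) + ∣ q ∣ * B)    ≤⟨ m≤n+m _ (10 + 2 * m) ⟩
    (10 + 2 * m) + (9 + ((5 + 2 * m) + ∣ q ∣ * B)) ≡⟨ regroup m (∣ q ∣ * B) ⟩
    B + (B + ∣ q ∣ * B)              ∎
    where
    open ≤-Reasoning
    regroup : ∀ m x → (10 + 2 * m) + (9 + ((5 + 2 * m) + x)) ≡ (12 + 2 * m) + ((12 + 2 * m) + x)
    regroup = solve-∀

  size-encodeQueries : (Q : List (Query Σ L)) → treeSize (encodeList encodeQuery Q) ≤ 1 + sum (map ∣_∣ Q) * (1 + B)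
  size-encodeQueries []      = ≤-refl
  size-encodeQueries (q ∷ Q) = begin
    1 + (treeSize (encodeQuery q) + treeSize (encodeList encodeQuery Q))
      ≤⟨ +-mono-≤ (query-size>0 q) (+-mono-≤ (size-encodeQuery q) (size-encodeQueries Q)) ⟩
    ∣ q ∣ + (∣ q ∣ * B + (1 + sum (map ∣_∣ Q) * (1 + B))) ≡⟨ regroup ∣ q ∣ B (sum (map ∣_∣ Q)) ⟩
    1 + (∣ q ∣ + sum (map ∣_∣ Q)) * (1 + B) ∎
    where
    open ≤-Reasoning
    regroup : ∀ x B s → x + (x * B + (1 + s * (1 + B))) ≡ 1 + (x + s) * (1 + B)
    regroup = solve-∀

opaque
  size-encodeInput : ∃[ a ] (∀ Σ {L} (Q : List (Query Σ L)) → treeSize (encodeInput Σ Q) ≤ pw a (inputSize Σ Q))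
  -- 28 is 1 + (9 + 18): the degrees of the two summands below, where a constant c is bounded with
  -- degree c.
  size-encodeInput = 28 , bound
    where
    bound : ∀ Σ {L} (Q : List (Query Σ L)) → treeSize (encodeInput Σ Q) ≤ pw 28 (inputSize Σ Q)
    bound Σ Q = begin
      1 + ((1 + (treeSize (encodeℕ (unary Σ)) + treeSize (encodeℕ (binary Σ)))) + treeSize (encodeList encodeQuery Q))
        ≤⟨ +-monoʳ-≤ 1 (+-mono-≤ (≤-reflexive (cong suc (cong₂ _+_ (size-encodeℕ (unary Σ)) (size-encodeℕ (binary Σ)))))
                                 (size-encodeQueries Q)) ⟩
      1 + ((1 + ((1 + 2 * unary Σ) + (1 + 2 * binary Σ))) + (1 + s * (1 + (12 + 2 * m))))
        ≡⟨ regroup (unary Σ) (binary Σ) s ⟩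
      (5 + 2 * m) + s * (13 + 2 * m)
        ≤⟨ pw-+ {1 + (5 + (2 + 1))} {1 + (1 + (13 + (2 + 1)))} N
             (pw-+ N (const≤pw 5 N) 2m≤) (pw-* N s≤ (pw-+ N (const≤pw 13 N) 2m≤)) ⟩
      pw _ N ∎
      where
      open ≤-Reasoning
      m s N : ℕ
      m = ∣ Σ ∣ₛ
      s = sum (map ∣_∣ Q)
      N = inputSize Σ Q
      2m≤ : 2 * m ≤ pw (2 + 1) N
      2m≤ = pw-* {2} {1} N (const≤pw 2 N) (≤-trans (m≤m+n m s) (≤pw₁ N))
      s≤ : s ≤ pw 1 N
      s≤ = ≤-trans (m≤n+m s m) (≤pw₁ N)
      regroup : ∀ u b s → 1 + ((1 + ((1 + 2 * u) + (1 + 2 * b))) + (1 + s * (1 + (12 + 2 * (u + b))))) ≡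
                          (5 + 2 * (u + b)) + s * (13 + 2 * (u + b))
      regroup = solve-∀

spine-encodeList : ∀ {enc : X → Tree} l → spine (encodeList enc l) ≡ length l
spine-encodeList []      = refl
spine-encodeList (x ∷ l) = cong suc (spine-encodeList l)

length-separatePools : (Q : List (Query Σ L)) → length (separatePools Q) ≡ length Q
length-separatePools []      = refl
length-separatePools (q ∷ Q) = cong suc (length-separatePools Q)

-- N is the size of the input and M that of the pools.
cost-exponent : ℕ → ℕ → ℕ → ℕ
cost-exponent e N M = (1 + ((2 + N) + (2 + M) * (3 * suc M))) * e

pw≤2^ : ∀ d M → pw d M ≤ 2 ^ ((2 + M) * d)
pw≤2^ d M = begin
  pw d M              ≡⟨ pw-def d M ⟩
  (2 + M) ^ d         ≤⟨ ^-monoˡ-≤ d (<⇒≤ (n<2^n (2 + M))) ⟩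
  (2 ^ (2 + M)) ^ d   ≡⟨ ^-*-assoc 2 (2 + M) d ⟩
  2 ^ ((2 + M) * d)   ∎
  where open ≤-Reasoning

2^-+ : ∀ {a b x y} → x ≤ 2 ^ a → y ≤ 2 ^ b → x + y ≤ 2 ^ (1 + (a + b))
2^-+ {a} {b} {x} {y} p q = begin
  x + y                      ≤⟨ +-mono-≤ (≤-trans p (^-monoʳ-≤ 2 (m≤m+n a b))) (≤-trans q (^-monoʳ-≤ 2 (m≤n+m b a))) ⟩
  2 ^ (a + b) + 2 ^ (a + b)  ≡⟨ cong (2 ^ (a + b) +_) (+-identityʳ _) ⟨
  2 ^ (1 + (a + b))          ∎
  where open ≤-Reasoning

cost≤2^ : ∀ e N M → pw e (N + pw (3 * suc M) M) ≤ 2 ^ cost-exponent e N M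
cost≤2^ e N M = begin
  pw e (N + τ)        ≡⟨ pw-def e _ ⟩
  (2 + N + τ) ^ e     ≤⟨ ^-monoˡ-≤ e (2^-+ {2 + N} {(2 + M) * (3 * suc M)} (<⇒≤ (n<2^n (2 + N))) (pw≤2^ (3 * suc M) M)) ⟩
  (2 ^ (1 + ((2 + N) + (2 + M) * (3 * suc M)))) ^ e ≡⟨ ^-*-assoc 2 (1 + ((2 + N) + (2 + M) * (3 * suc M))) e ⟩
  2 ^ cost-exponent e N M ∎
  where
  open ≤-Reasoning
  τ : ℕ
  τ = pw (3 * suc M) M

opaque
  cost-exponent≤pw : ∀ e a b → ∃[ d ] (∀ x {N M} → N ≤ pw a x → M ≤ pw b x → cost-exponent e N M ≤ pw d x)
  cost-exponent≤pw e a b = _ , λ x {N} {M} N≤ M≤ →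
    pw-* {d = _} {e} x (pw-+ {1} {_} x (const≤pw 1 x) (pw-+ {1 + (2 + a)} {(1 + (2 + b)) + (3 + (1 + (1 + b)))} x (pw-+ {2} {a} x (const≤pw 2 x) N≤)
      (pw-* x (pw-+ {2} {b} x (const≤pw 2 x) M≤) (pw-* {3} {1 + (1 + b)} x (const≤pw 3 x) (pw-+ {1} {b} x (const≤pw 1 x) M≤)))))
    (const≤pw e x)

opaque
  -- The bound `k` on the number of pools is left open: a constant makes the cost polynomial, while
  -- `k = M` covers any number of pools and gives an exponential cost.
  program-spec : ∀ {pools} → Ok nothing pools →
    ∃[ a ] ∃[ b ] ∃[ e ] (∀ Σ {L} (Q : List (Query Σ L)) ls → val pools (encodeInput Σ Q ∷ []) ≡ encodePoints ls →
      let x = inputSize Σ Q in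
      ∃[ N ] ∃[ M ] (N ≤ pw a x × M ≤ pw b x × length ls ≤ M ×
        (∀ k → length ls ≤ k →
          program pools maps encodeInput Σ Q to encodeOutput (members Q (selections ls))
            within pw e (N + pw (3 * suc k) M))))
  program-spec {pools} ok = a , (2 + a) * d , e , λ Σ Q ls eq →
    treeSize (encodeInput Σ Q) , treeSize (val pools (encodeInput Σ Q ∷ [])) , input≤ Σ Q
    , pw-∘ _ (proj₁ (runs (encodeInput Σ Q))) (input≤ Σ Q) , length≤ Σ Q ls eq , maps Σ Q ls eq
    where
    a d e : ℕ
    a = proj₁ size-encodeInput
    d = proj₁ (program-runs ok)
    e = proj₁ (proj₂ (program-runs ok))
    input≤ : ∀ Σ {L} (Q : List (Query Σ L)) → treeSize (encodeInput Σ Q) ≤ pw a (inputSize Σ Q)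
    input≤ = proj₂ size-encodeInput
    runs : ∀ input → let T = choicesT (val pools (input ∷ [])) in
      (treeSize (val pools (input ∷ [])) ≤ pw d (treeSize input)) ×
      (∀ τ → treeSize T ≤ τ →
        program pools maps input to val memberE (T ∷ input ∷ []) within pw e (treeSize input + τ))
    runs = proj₂ (proj₂ (program-runs ok))
    module _ (Σ : Signature) {L : Language} (Q : List (Query Σ L)) (ls : List (Point Σ L))
             (eq : val pools (encodeInput Σ Q ∷ []) ≡ encodePoints ls) where
      input P : Tree
      input = encodeInput Σ Q
      P = val pools (input ∷ [])
      spine-P : spine P ≡ length ls
      spine-P = trans (cong spine eq) (spine-encodeList ls)
      length≤ : length ls ≤ treeSize P
      length≤ = ≤-trans (≤-reflexive (sym spine-P)) (≤-trans (n≤1+n _) (spine≤size P))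
      maps : ∀ k → length ls ≤ k → program pools maps input to encodeOutput (members Q (selections ls))
               within pw e (treeSize input + pw (3 * suc k) (treeSize P))
      maps k ls≤k = subst (λ out → program pools maps input to out within pw e (treeSize input + pw (3 * suc k) (treeSize P)))
        (trans (cong (λ T → val memberE (T ∷ input ∷ [])) (trans (cong choicesT eq) (choicesT-selections ls)))
               (memberE-members Q (selections ls)))
        (proj₂ (runs input) (pw (3 * suc k) (treeSize P))
          (≤-trans (size-choicesT P (treeSize P) ≤-refl)
                   (pw-monoʳ (treeSize P) (*-monoʳ-≤ 3 (s≤s (≤-trans (≤-reflexive spine-P) ls≤k))))))

weaken : ∀ {p input output C D} → C ≤ D → p maps input to output within C → p maps input to output within D
weaken C≤D (c , d , c≤) = c , d , ≤-trans c≤ C≤D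

polynomial-time : (n : ℕ) → ∃[ prog ] ∃[ f ]
  ((Σ : Signature) (Q : List (Query Σ EL)) → length Q ≤ n →
    ∃[ S ] (IsSplitPartner Q S × prog maps encodeInput Σ Q to encodeOutput S within eval f (inputSize Σ Q)))
polynomial-time n =
  let a , b , e , spec = program-spec {separatePoolsE} it
      -- There are at most `n` pools, so the exponent `3 * suc n` of the enumeration is a constant.
      c = 1 + (a + (2 + b) * (3 * suc n))
      f , f≤ = pw≤eval ((2 + c) * e)
  in program separatePoolsE , f , λ Σ Q Q≤n →
  members Q (selections (separatePools Q)) , split-partner-EL Q ,
  (let x = inputSize Σ Q
       N , M , N≤ , M≤ , _ , maps = spec Σ Q (separatePools Q) (separatePoolsE-correct Q)
   in weaken {program separatePoolsE}
        (≤-trans (pw-∘ {e} {c} x ≤-refl (pw-+ x N≤ (pw-∘ x ≤-refl M≤))) (f≤ x))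
        (maps n (≤-trans (≤-reflexive (length-separatePools Q)) Q≤n)))

exponential-time : ∃[ prog ] ∃[ f ]
  ((Σ : Signature) (Q : List (Query Σ ELI)) →
    ∃[ S ] (IsSplitPartner Q S × prog maps encodeInput Σ Q to encodeOutput S within (2 ^ eval f (inputSize Σ Q))))
exponential-time =
  let a , b , e , spec = program-spec {commonPoolE} it
      d , exponent≤ = cost-exponent≤pw e a b
      f , f≤ = pw≤eval d
  in program commonPoolE , f , λ Σ Q →
  members Q (selections (commonPool Q)) , split-partner-ELI Q ,
  (let x = inputSize Σ Q
       N , M , N≤ , M≤ , length≤ , maps = spec Σ Q (commonPool Q) (commonPoolE-correct Q)
   in weaken {program commonPoolE}
        (≤-trans (cost≤2^ e N M) (^-monoʳ-≤ 2 (≤-trans (exponent≤ x N≤ M≤) (f≤ x))))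
        (maps M length≤))

theorem30 : ((n : ℕ) → 0 < n →
    ∃[ prog ] ∃[ f ]
    ((Σ : Signature) (Q : List (Query Σ EL)) → length Q ≤ n →
    ∃[ S ] (IsSplitPartner Q S
    × prog maps encodeInput Σ Q to encodeOutput S within eval f (inputSize Σ Q))))
    ×
    (∃[ prog ] ∃[ f ]
    ((Σ : Signature) (Q : List (Query Σ ELI)) →
    ∃[ S ] (IsSplitPartner Q S
    × prog maps encodeInput Σ Q to encodeOutput S within (2 ^ eval f (inputSize Σ Q)))))
    ×
    (¬ (∃[ f ]
    ((Σ : Signature) (q : Query Σ ELI) →
    ∃[ S ] (IsSplitPartner (q ∷ []) S
    × totalSize S ≤ eval f (∣ q ∣ + ∣ Σ ∣ₛ)))))
theorem30 = (λ n _ → polynomial-time n) , exponential-time , no-polynomial-bound
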